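{- Let $\mathcal{R}$ be a commutative ring containing $\mathbb{Q}$ and let $\phi(x)=\sum_{k\ge 0}\phi[k]\frac{x^k}{k!}\in\mathcal{R}[[x]]$ with $\phi[0]\neq 0$. Let $P_\phi(t,q)=\sum_{n\ge 1}p_n^{\phi}(q)\frac{t^n}{n!}$ with $$p_n^{\phi}(q)=\sum_{T} q^{\mathrm{pl}(T)}\prod_{v\in[n]}\phi\big[\,|T^{ -1}(v)|\,\big],$$ the sum being over all increasing rooted trees $T$ with vertex set $[n]$, and put $$F_\phi(t,q)=\phi(P_\phi(t,q))=\sum_{n\ge 0}f_n^{\phi}(q)\frac{t^n}{n!}.$$ Then $$F_\phi(t,q)=\frac{\partial P_\phi(u,q)}{\partial u}\Big|_{u=t/q}.$$ Equivalently, $f_n^{\phi}(q)=q^{ -n}p_{n+1}^{\phi}(q)$ for all $n\ge 0$.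
   Context: $[n]=\{1,\dots,n\}$. An increasing rooted tree on $[n]$ is a (non-plane) labelled rooted tree with vertex set $[n]$ whose labels increase along every path from the root to the leaves. $T^{ -1}(v)$ denotes the (possibly empty) set of children of the vertex $v$. The height of a vertex is the number of edges on the path from it to the root, and the path length $\mathrm{pl}(T)$ is the sum of the heights of all vertices of $T$. The series $F_\phi(t,q)$ is the generating function of $\phi$-forests of $\phi$-enriched increasing trees enumerated by path length. The identities are read in $\mathcal{R}[q,q^{ -1}][[t]]$. -}

module Defs where

open import Algebra.Bundles using (CommutativeRing; RawRing; RawSemiring)
import Algebra.Definitions.RawSemiring as RawSemiringDefs
open import Data.Fin.Base as Fin using (Fin; toℕ)
import Data.Fin.Properties as Fin
open import Data.Integer.Base as ℤ using (ℤ; +_; 0ℤ)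
import Data.Integer.Properties as ℤ
open import Data.List.Base as List
  using (List; []; _∷_; _++_; allFin; cartesianProductWith; filter; foldr; length; mapMaybe)
open import Data.Maybe.Base as Maybe using (Maybe; just; nothing; _>>=_)
import Data.Maybe.Properties as Maybe
open import Data.Maybe.Relation.Unary.All as MaybeAll using (just)
open import Data.Nat.Base as ℕ using (ℕ; zero; suc; _∸_; _!; z≤n)
open import Data.Nat.ListAction using () renaming (sum to sumℕ)
import Data.Nat.Properties as ℕ
open import Data.Product.Base using (∃; _×_; _,_; proj₁; proj₂)
open import Data.Rational.Base as ℚ using (ℚ)
open import Data.Vec.Base using (Vec; []; _∷_; lookup)
open import Function.Base using (_∘_)
open import Relation.Binary.PropositionalEquality using (_≡_; subst; sym)
open import Relation.Nullary.Decidable using (Dec; yes; no; _×-dec_; map′; dec⇒maybe)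

------------------------------------------------------------------------
-- Increasing rooted trees, with Fin n in place of [n]. A rooted tree is
-- recorded by the map T sending each vertex to its parent (and the root
-- to nothing), so that the children of v form the fibre T⁻¹(v).

ParentMap : ℕ → Set
ParentMap n = Vec (Maybe (Fin n)) n

module _ {n : ℕ} (T : ParentMap n) where

  parent : Fin n → Maybe (Fin n)
  parent = lookup T

  -- ancestor k v ≡ just w iff the path from v towards the root reaches w
  -- after exactly k edges.
  ancestor : ℕ → Fin n → Maybe (Fin n)
  ancestor zero    v = just v
  ancestor (suc k) v = parent v >>= ancestor k

  IsRoot : Fin n → Set
  IsRoot r = parent r ≡ nothing × (∀ v → ∃ λ k → ancestor k v ≡ just r)

  IsRootedTree : Set
  IsRootedTree = ∃ IsRoot

  IsIncreasing : Set
  IsIncreasing = ∀ v → MaybeAll.All (Fin._< v) (parent v)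

  IsIncreasingTree : Set
  IsIncreasingTree = IsIncreasing × IsRootedTree

  ancestor-≤ : IsIncreasing → ∀ k {v w} → ancestor k v ≡ just w → k ℕ.≤ toℕ v
  ancestor-≤ inc zero        _  = z≤n
  ancestor-≤ inc (suc k) {v} eq with parent v | inc v
  ... | just u | just u<v = ℕ.≤-<-trans (ancestor-≤ inc k eq) u<v

  isRootedTree? : IsIncreasing → Dec IsRootedTree
  isRootedTree? inc = Fin.any? λ r →
    Maybe.≡-dec Fin._≟_ (parent r) nothing ×-dec Fin.all? λ v →
    map′ (λ (k , eq) → toℕ k , eq)
         (λ (k , eq) → let k<n = ℕ.≤-<-trans (ancestor-≤ inc k eq) (Fin.toℕ<n v) in
            Fin.fromℕ< k<n ,
            subst (λ j → ancestor j v ≡ just r) (sym (Fin.toℕ-fromℕ< k<n)) eq)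
         (Fin.any? {n} λ k → Maybe.≡-dec Fin._≟_ (ancestor (toℕ k) v) (just r))

  isIncreasingTree? : Dec IsIncreasingTree
  isIncreasingTree? with Fin.all? (λ v → MaybeAll.dec (Fin._<? v) (parent v))
  ... | no ¬inc = no (¬inc ∘ proj₁)
  ... | yes inc = map′ (inc ,_) proj₂ (isRootedTree? inc)

  children : Fin n → List (Fin n)
  children v = filter (λ u → Maybe.≡-dec Fin._≟_ (parent u) (just v)) (allFin n)

IncreasingTree : ℕ → Set
IncreasingTree n = ∃ λ (T : ParentMap n) → IsIncreasingTree T

height : ∀ {n} → IncreasingTree n → Fin n → ℕ
height (_ , _ , _ , _ , pathToRoot) v = proj₁ (pathToRoot v)

pathLength : ∀ {n} → IncreasingTree n → ℕ
pathLength {n} T = sumℕ (List.map (height T) (allFin n))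

-- All vectors with entries in xs, each listed once if xs has no repetitions.
vectors : {A : Set} → List A → ∀ n → List (Vec A n)
vectors xs zero    = [] ∷ []
vectors xs (suc n) = cartesianProductWith _∷_ xs (vectors xs n)

parentMaps : ∀ n → List (ParentMap n)
parentMaps n = vectors (nothing ∷ List.map just (allFin n)) n

increasingTrees : ∀ n → List (IncreasingTree n)
increasingTrees n =
  mapMaybe (λ T → Maybe.map (T ,_) (dec⇒maybe (isIncreasingTree? T))) (parentMaps n)

------------------------------------------------------------------------
-- Laurent polynomials R[q,q⁻¹]: a list of pairs (i , a) is the formal sum
-- of the monomials a qⁱ, and two lists are equal when all their
-- coefficients agree.

module Laurent {c ℓ} (R : RawRing c ℓ) where
  open RawRing R

  Laurent : Set c
  Laurent = List (ℤ × Carrier)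

  coeff : Laurent → ℤ → Carrier
  coeff []            k = 0#
  coeff ((i , a) ∷ f) k with i ℤ.≟ k
  ... | yes _ = a + coeff f k
  ... | no  _ = coeff f k

  const : Carrier → Laurent
  const a = (0ℤ , a) ∷ []

  q^_ : ℤ → Laurent
  q^ i = (i , 1#) ∷ []

  laurentRing : RawRing c ℓ
  laurentRing = record
    { Carrier = Laurent
    ; _≈_     = λ f g → ∀ k → coeff f k ≈ coeff g k
    ; _+_     = _++_
    ; _*_     = cartesianProductWith λ (i , a) (j , b) → i ℤ.+ j , a * b
    ; -_      = List.map λ (i , a) → i , - a
    ; 0#      = []
    ; 1#      = const 1#
    }

------------------------------------------------------------------------
-- Formal power series K[[t]]; f n is the coefficient of tⁿ in f.

module PowerSeries {c ℓ} (K : RawSemiring c ℓ) where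
  open RawSemiring K
  open RawSemiringDefs K using (sum) renaming (_×_ to _·_)

  Series : Set c
  Series = ℕ → Carrier

  sum≤ : ℕ → (ℕ → Carrier) → Carrier
  sum≤ n g = sum {suc n} (g ∘ toℕ)

  seriesSemiring : RawSemiring c ℓ
  seriesSemiring = record
    { Carrier = Series
    ; _≈_     = λ f g → ∀ n → f n ≈ g n
    ; _+_     = λ f g n → f n + g n
    ; _*_     = λ f g n → sum≤ n λ k → f k * g (n ∸ k)
    ; 0#      = λ _ → 0#
    ; 1#      = λ { zero → 1# ; (suc _) → 0# }
    }

  open RawSemiringDefs seriesSemiring using (_^_)

  _*t : Carrier → Series
  (a *t) 1 = a
  (a *t) _ = 0#

  -- The substitution f(g(t)) = Σₖ fₖ g(t)ᵏ for g with zero constant term: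
  -- then gᵏ does not contribute to tⁿ when k > n.
  _⟨_⟩ : Series → Series → Series
  (f ⟨ g ⟩) n = sum≤ n λ k → f k * (g ^ k) n

  ∂ : Series → Series
  ∂ f n = suc n · f (suc n)

------------------------------------------------------------------------
-- ι is the inclusion of ℚ in R, and φ k stands for φ[k].

module EnrichedTrees {c ℓ} (R : CommutativeRing c ℓ)
  (ι : ℚ → CommutativeRing.Carrier R) (φ : ℕ → CommutativeRing.Carrier R) where

  private module R = CommutativeRing R

  open Laurent R.rawRing public
  open RawRing laurentRing public
  open RawSemiringDefs rawSemiring public using () renaming (_×_ to _·_)
  open PowerSeries rawSemiring public
  open RawSemiring seriesSemiring public using () renaming (_≈_ to _≈ₛ_)

  -- Σₙ aₙ tⁿ / n!
  egf : (ℕ → Laurent) → Series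
  egf a n = const (ι (ℚ._/_ (+ 1) (n !) ⦃ n ℕ.!≢0 ⦄)) * a n

  weight : ∀ {n} → IncreasingTree n → Laurent
  weight {n} T =
    q^ (+ pathLength T) *
    const (foldr R._*_ R.1# (List.map (φ ∘ length ∘ children (proj₁ T)) (allFin n)))

  p : ℕ → Laurent
  p n = foldr _+_ 0# (List.map weight (increasingTrees n))

  P : Series
  P = egf λ { zero → 0# ; n@(suc _) → p n }

  F : Series
  F = egf (const ∘ φ) ⟨ P ⟩

  f : ℕ → Laurent
  f n = (n !) · F n

-- An increasing tree grows by attaching the vertices 2, …, n in order, each below an
-- earlier one. Let X i h be the exponential generating series of the subtrees that grow
-- from a vertex of height h which has i children already, where every vertex has the
-- weight q^height φ[number of children]. A tree grows at one of its vertices at a time,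
-- so the series of a set of initial vertices is the product of their series (Leibniz
-- rule), and differentiating X i h once, i.e. attaching one child to that vertex, gives
--   X i h ′ = X (i + 1) h · X 0 (h + 1).
-- Here X 0 0 = P′, and raising all heights by one gives X 0 1 (t) = q P′(qt) = (P(qt))′.
-- Hence X i 0 ′ = X (i + 1) 0 · (P(qt))′ with constant terms φ[i], and Taylor expansion
-- yields P′(t) = X 0 0 (t) = φ(P(qt)).

module Submission where

open import Algebra.Bundles
  using (CommutativeMonoid; CommutativeRing; CommutativeSemiring; RawRing; RawSemiring)
import Algebra.Definitions.RawSemiring as RawSemiringDefs
open import Algebra.Morphism.Structures using (module RingMorphisms)
import Algebra.Properties.CommutativeMonoid.Mult as CommutativeMonoidMult
import Algebra.Properties.CommutativeSemigroup as CommutativeSemigroupProperties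
import Algebra.Properties.Semiring.Exp as SemiringExp
import Algebra.Properties.Semiring.Mult as SemiringMult
import Algebra.Properties.Semiring.Sum as SemiringSum
open import Algebra.Structures using (IsCommutativeMonoid)
open import Algebra.Structures.Biased using (isCommutativeMonoidˡ; isCommutativeSemiringˡ)
open import Data.Fin.Base as Fin using (Fin; toℕ; zero; suc)
open import Data.Fin.Induction using (<-wellFounded)
import Data.Fin.Properties as Fin
open import Data.Integer.Base as ℤ using (ℤ; +_; -1ℤ; 0ℤ)
import Data.Integer.Properties as ℤ
open import Data.Integer.Tactic.RingSolver using (solve-∀)
open import Data.List.Base as List
  using (List; []; _∷_; _++_; allFin; cartesianProductWith; filter; foldr; length; mapMaybe)
import Data.List.Properties as List
open import Data.Maybe.Base as Maybe using (Maybe; just; nothing; _>>=_)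
import Data.Maybe.Properties as Maybe
open import Data.Maybe.Relation.Unary.All as MaybeAll using (just; nothing)
open import Data.Nat.Base as ℕ using (ℕ; zero; suc; _∸_; _!; _≤_; z≤n; s≤s)
open import Data.Nat.ListAction using () renaming (sum to sumℕ)
import Data.Nat.Properties as ℕ
open import Data.Product.Base using (∃; _×_; _,_; proj₁; proj₂)
open import Data.Rational.Base as ℚ using (ℚ; +-*-rawRing)
import Data.Rational.Properties as ℚ
open import Data.Rational.Unnormalised.Base as ℚᵘ using (mkℚᵘ; *≡*)
import Data.Rational.Unnormalised.Properties as ℚᵘ
open import Data.Vec.Base as Vec using (Vec; []; _∷_; lookup)
open import Function.Base using (_∘_)
open import Induction.WellFounded using (Acc; acc)
open import Relation.Binary.PropositionalEquality as ≡ using (_≡_; _≢_)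
import Relation.Binary.Reasoning.Setoid as SetoidReasoning
open import Relation.Nullary.Decidable using (Dec; yes; no; dec⇒maybe)
open import Relation.Nullary.Negation.Core using (¬_; contradiction)
open import Defs

-- Laurent polynomials

module LaurentRing {c ℓ} (R : CommutativeRing c ℓ) where
  open CommutativeRing R hiding (zero)
  open SetoidReasoning setoid
  open Laurent rawRing
  private
    module L = RawRing laurentRing

  coeff-∷ : ∀ {i j a b f g} k → i ≡ j → a ≈ b → coeff f k ≈ coeff g k →
            coeff ((i , a) ∷ f) k ≈ coeff ((j , b) ∷ g) k
  coeff-∷ {i} k ≡.refl a≈b f≈g with i ℤ.≟ k
  ... | yes _ = +-cong a≈b f≈g
  ... | no  _ = f≈g

  coeff-++ : ∀ f g k → coeff (f ++ g) k ≈ coeff f k + coeff g k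
  coeff-++ []            g k = sym (+-identityˡ _)
  coeff-++ ((i , a) ∷ f) g k with i ℤ.≟ k
  ... | yes _ = trans (+-congˡ (coeff-++ f g k)) (sym (+-assoc _ _ _))
  ... | no  _ = coeff-++ f g k

  ++-cong : ∀ f f′ g g′ → f L.≈ f′ → g L.≈ g′ → f ++ g L.≈ f′ ++ g′
  ++-cong f f′ g g′ f≈ g≈ k =
    trans (coeff-++ f g k) (trans (+-cong (f≈ k) (g≈ k)) (sym (coeff-++ f′ g′ k)))

  ++-comm : ∀ f g → f ++ g L.≈ g ++ f
  ++-comm f g k = trans (coeff-++ f g k) (trans (+-comm _ _) (sym (coeff-++ g f k)))

  ++-isCommutativeMonoid : IsCommutativeMonoid L._≈_ L._+_ L.0#
  ++-isCommutativeMonoid = isCommutativeMonoidˡ record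
    { isSemigroup = record
      { isMagma = record
        { isEquivalence = record
          { refl  = λ k → refl
          ; sym   = λ f≈g k → sym (f≈g k)
          ; trans = λ f≈g g≈h k → trans (f≈g k) (g≈h k)
          }
        ; ∙-cong = λ {f} {f′} {g} {g′} → ++-cong f f′ g g′
        }
      ; assoc = λ f g h k → reflexive (≡.cong (λ l → coeff l k) (List.++-assoc f g h))
      }
    ; identityˡ = λ f k → refl
    ; comm = ++-comm
    }

  ++-commutativeMonoid : CommutativeMonoid c ℓ
  ++-commutativeMonoid = record { isCommutativeMonoid = ++-isCommutativeMonoid }

  module Add = CommutativeMonoid ++-commutativeMonoid
  open CommutativeSemigroupProperties Add.commutativeSemigroup using (x∙yz≈y∙xz)

  shift : ℤ × Carrier → Laurent → Laurent
  shift (i , a) = List.map λ (j , b) → i ℤ.+ j , a * b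

  coeff-shift : ∀ i a g k → coeff (shift (i , a) g) k ≈ a * coeff g (k ℤ.- i)
  coeff-shift i a []            k = sym (zeroʳ a)
  coeff-shift i a ((j , b) ∷ g) k with i ℤ.+ j ℤ.≟ k | j ℤ.≟ k ℤ.- i
  ... | yes _  | yes _  = trans (+-congˡ (coeff-shift i a g k)) (sym (distribˡ a b _))
  ... | no  _  | no  _  = coeff-shift i a g k
  ... | yes eq | no neq = contradiction (≡.trans (subtract i j) (≡.cong (ℤ._- i) eq)) neq
    where
    subtract : ∀ i j → j ≡ i ℤ.+ j ℤ.- i
    subtract = solve-∀
  ... | no neq | yes ≡.refl = contradiction (add i k) neq
    where
    add : ∀ i k → i ℤ.+ (k ℤ.- i) ≡ k
    add = solve-∀

  shift-cong : ∀ x {g h} → g L.≈ h → shift x g L.≈ shift x h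
  shift-cong (i , a) {g} {h} g≈h k = begin
    coeff (shift (i , a) g) k  ≈⟨ coeff-shift i a g k ⟩
    a * coeff g (k ℤ.- i)      ≈⟨ *-congˡ (g≈h _) ⟩
    a * coeff h (k ℤ.- i)      ≈⟨ coeff-shift i a h k ⟨
    coeff (shift (i , a) h) k  ∎

  shift-shift : ∀ i a j b g → shift (i ℤ.+ j , a * b) g L.≈ shift (i , a) (shift (j , b) g)
  shift-shift i a j b []            k = refl
  shift-shift i a j b ((l , d) ∷ g) k =
    coeff-∷ k (ℤ.+-assoc i j l) (*-assoc a b d) (shift-shift i a j b g k)

  *-congˡ-≈ : ∀ f {g h} → g L.≈ h → f L.* g L.≈ f L.* h
  *-congˡ-≈ []      g≈h k = refl
  *-congˡ-≈ (x ∷ f) {g} {h} g≈h =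
    ++-cong (shift x g) (shift x h) (f L.* g) (f L.* h) (shift-cong x {g} {h} g≈h) (*-congˡ-≈ f g≈h)

  *-[] : ∀ f → f L.* [] ≡ []
  *-[] []      = ≡.refl
  *-[] (x ∷ f) = *-[] f

  *-∷ : ∀ f x g → f L.* (x ∷ g) L.≈ shift x f ++ f L.* g
  *-∷ []              x           g k = refl
  *-∷ (y@(j , b) ∷ f) x@(i , a) g k = coeff-∷ k (ℤ.+-comm j i) (*-comm b a) (begin
    coeff (shift y g ++ f L.* (x ∷ g)) k
      ≈⟨ Add.∙-congˡ {shift y g} (*-∷ f x g) k ⟩
    coeff (shift y g ++ (shift x f ++ f L.* g)) k
      ≈⟨ x∙yz≈y∙xz (shift y g) (shift x f) (f L.* g) k ⟩
    coeff (shift x f ++ (shift y g ++ f L.* g)) k  ∎)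

  *-comm-≈ : ∀ f g → f L.* g L.≈ g L.* f
  *-comm-≈ []      g k = reflexive (≡.cong (λ l → coeff l k) (≡.sym (*-[] g)))
  *-comm-≈ (x ∷ f) g k = begin
    coeff (shift x g ++ f L.* g) k  ≈⟨ Add.∙-congˡ {shift x g} (*-comm-≈ f g) k ⟩
    coeff (shift x g ++ g L.* f) k  ≈⟨ *-∷ g x f k ⟨
    coeff (g L.* (x ∷ f)) k         ∎

  *-cong-≈ : ∀ {f f′ g g′} → f L.≈ f′ → g L.≈ g′ → f L.* g L.≈ f′ L.* g′
  *-cong-≈ {f} {f′} {g} {g′} f≈ g≈ k = begin
    coeff (f L.* g) k    ≈⟨ *-congˡ-≈ f g≈ k ⟩
    coeff (f L.* g′) k   ≈⟨ *-comm-≈ f g′ k ⟩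
    coeff (g′ L.* f) k   ≈⟨ *-congˡ-≈ g′ f≈ k ⟩
    coeff (g′ L.* f′) k  ≈⟨ *-comm-≈ g′ f′ k ⟩
    coeff (f′ L.* g′) k  ∎

  *-distribʳ-++ : ∀ h f g → (f ++ g) L.* h L.≈ f L.* h ++ g L.* h
  *-distribʳ-++ h []      g k = refl
  *-distribʳ-++ h (x ∷ f) g k = trans
    (Add.∙-congˡ {shift x h} (*-distribʳ-++ h f g) k)
    (sym (Add.assoc (shift x h) (f L.* h) (g L.* h) k))

  shift-* : ∀ x f g → shift x f L.* g L.≈ shift x (f L.* g)
  shift-* x           []              g k = refl
  shift-* x@(i , a) (y@(j , b) ∷ f) g k = begin
    coeff (shift (i ℤ.+ j , a * b) g ++ shift x f L.* g) k
      ≈⟨ ++-cong (shift (i ℤ.+ j , a * b) g) (shift x (shift y g))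
                 (shift x f L.* g) (shift x (f L.* g))
           (shift-shift i a j b g) (shift-* x f g) k ⟩
    coeff (shift x (shift y g) ++ shift x (f L.* g)) k
      ≡⟨ ≡.cong (λ l → coeff l k) (List.map-++ _ (shift y g) (f L.* g)) ⟨
    coeff (shift x (shift y g ++ f L.* g)) k ∎

  *-assoc-≈ : ∀ f g h → (f L.* g) L.* h L.≈ f L.* (g L.* h)
  *-assoc-≈ []      g h k = refl
  *-assoc-≈ (x ∷ f) g h k = trans
    (*-distribʳ-++ h (shift x g) (f L.* g) k)
    (++-cong (shift x g L.* h) (shift x (g L.* h)) ((f L.* g) L.* h) (f L.* (g L.* h))
      (shift-* x g h) (*-assoc-≈ f g h) k)

  *-identityˡ-≈ : ∀ f → L.1# L.* f L.≈ f
  *-identityˡ-≈ []            k = refl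
  *-identityˡ-≈ ((i , a) ∷ f) k = coeff-∷ k (ℤ.+-identityˡ i) (*-identityˡ a) (*-identityˡ-≈ f k)

  laurentSemiring : CommutativeSemiring c ℓ
  laurentSemiring = record
    { Carrier = Laurent
    ; _≈_ = L._≈_
    ; _+_ = L._+_
    ; _*_ = L._*_
    ; 0# = L.0#
    ; 1# = L.1#
    ; isCommutativeSemiring = isCommutativeSemiringˡ record
      { +-isCommutativeMonoid = ++-isCommutativeMonoid
      ; *-isCommutativeMonoid = isCommutativeMonoidˡ record
        { isSemigroup = record
          { isMagma = record
            { isEquivalence = Add.isEquivalence
            ; ∙-cong = λ {f} {f′} {g} {g′} → *-cong-≈ {f} {f′} {g} {g′}
            }
          ; assoc = *-assoc-≈
          }
        ; identityˡ = *-identityˡ-≈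
        ; comm = *-comm-≈
        }
      ; distribʳ = *-distribʳ-++
      ; zeroˡ = λ f k → refl
      }
    }

infixl 8 _[_]≔_

_[_]≔_ : ∀ {a} {A : Set a} → (ℕ → A) → ℕ → A → ℕ → A
(A [ zero  ]≔ B) zero    = B
(A [ zero  ]≔ B) (suc v) = A (suc v)
(A [ suc u ]≔ B) zero    = A zero
(A [ suc u ]≔ B) (suc v) = (A ∘ suc [ u ]≔ B) v

[]≔-updated : ∀ {a} {A : Set a} (f : ℕ → A) u {x} → (f [ u ]≔ x) u ≡ x
[]≔-updated f zero    = ≡.refl
[]≔-updated f (suc u) = []≔-updated (f ∘ suc) u

[]≔-minimal : ∀ {a} {A : Set a} (f : ℕ → A) {u v x} → v ≢ u → (f [ u ]≔ x) v ≡ f v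
[]≔-minimal f {zero}  {zero}  v≢u = contradiction ≡.refl v≢u
[]≔-minimal f {zero}  {suc v} v≢u = ≡.refl
[]≔-minimal f {suc u} {zero}  v≢u = ≡.refl
[]≔-minimal f {suc u} {suc v} v≢u = []≔-minimal (f ∘ suc) (v≢u ∘ ≡.cong suc)

-- Hurwitz series

-- A sequence f stands for Σₙ f n tⁿ/n!, so that f ∘ suc is its derivative, and ⊛ is
-- defined by the Leibniz rule.
module HurwitzSeries {c ℓ} (K : CommutativeSemiring c ℓ) where
  open CommutativeSemiring K hiding (zero)
  open SemiringSum semiring
  open SemiringMult semiring
    using (×-congʳ; ×-congˡ; ×-assocˡ; ×-homo-+; ×-homo-1; ×-comm-*; ×-assoc-*)
    renaming (_×_ to _·_)
  open CommutativeMonoidMult +-commutativeMonoid using (×-distrib-+)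
  open SemiringExp semiring using (_^_)
  open CommutativeSemigroupProperties +-commutativeSemigroup
    using () renaming (interchange to +-interchange)
  open CommutativeSemigroupProperties *-commutativeSemigroup
    using (x∙yz≈y∙xz) renaming (interchange to *-interchange)
  open SetoidReasoning setoid
  open PowerSeries rawSemiring using (Series; seriesSemiring; _*t; _⟨_⟩)

  infixl 7 _⊛_ _⊙_
  infixl 6 _⊕_

  _⊕_ : Series → Series → Series
  (f ⊕ g) n = f n + g n

  _⊛_ : Series → Series → Series
  (f ⊛ g) zero    = f 0 * g 0
  (f ⊛ g) (suc n) = (f ∘ suc ⊛ g) n + (f ⊛ g ∘ suc) n

  _⊙_ : Carrier → Series → Series
  (a ⊙ f) n = a * f n

  𝟘 𝟙 : Series
  𝟘 _ = 0#
  𝟙 zero    = 1#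
  𝟙 (suc _) = 0#

  ⊛-cong-≤ : ∀ n {f f′ g g′} → (∀ {m} → m ≤ n → f m ≈ f′ m) →
             (∀ {m} → m ≤ n → g m ≈ g′ m) → (f ⊛ g) n ≈ (f′ ⊛ g′) n
  ⊛-cong-≤ zero    f≈ g≈ = *-cong (f≈ z≤n) (g≈ z≤n)
  ⊛-cong-≤ (suc n) f≈ g≈ = +-cong
    (⊛-cong-≤ n (f≈ ∘ s≤s) (g≈ ∘ ℕ.m≤n⇒m≤1+n))
    (⊛-cong-≤ n (f≈ ∘ ℕ.m≤n⇒m≤1+n) (g≈ ∘ s≤s))

  ⊛-cong : ∀ {f f′ g g′} → (∀ n → f n ≈ f′ n) → (∀ n → g n ≈ g′ n) →
           ∀ n → (f ⊛ g) n ≈ (f′ ⊛ g′) n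
  ⊛-cong f≈ g≈ n = ⊛-cong-≤ n (λ {m} _ → f≈ m) (λ {m} _ → g≈ m)

  ⊛-comm : ∀ f g n → (f ⊛ g) n ≈ (g ⊛ f) n
  ⊛-comm f g zero    = *-comm _ _
  ⊛-comm f g (suc n) = trans (+-cong (⊛-comm _ g n) (⊛-comm f _ n)) (+-comm _ _)

  ⊛-distribʳ : ∀ h f g n → ((f ⊕ g) ⊛ h) n ≈ (f ⊛ h) n + (g ⊛ h) n
  ⊛-distribʳ h f g zero    = distribʳ _ _ _
  ⊛-distribʳ h f g (suc n) =
    trans (+-cong (⊛-distribʳ h _ _ n) (⊛-distribʳ _ f g n)) (+-interchange _ _ _ _)

  ⊛-distribˡ : ∀ f g h n → (f ⊛ (g ⊕ h)) n ≈ (f ⊛ g) n + (f ⊛ h) n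
  ⊛-distribˡ f g h n = begin
    (f ⊛ (g ⊕ h)) n        ≈⟨ ⊛-comm f _ n ⟩
    ((g ⊕ h) ⊛ f) n        ≈⟨ ⊛-distribʳ f g h n ⟩
    (g ⊛ f) n + (h ⊛ f) n  ≈⟨ +-cong (⊛-comm g f n) (⊛-comm h f n) ⟩
    (f ⊛ g) n + (f ⊛ h) n  ∎

  ⊛-assoc : ∀ f g h n → ((f ⊛ g) ⊛ h) n ≈ (f ⊛ (g ⊛ h)) n
  ⊛-assoc f g h zero    = *-assoc _ _ _
  ⊛-assoc f g h (suc n) = begin
    ((f ∘ suc ⊛ g ⊕ f ⊛ g ∘ suc) ⊛ h) n + ((f ⊛ g) ⊛ h ∘ suc) n
      ≈⟨ +-congʳ (⊛-distribʳ h _ _ n) ⟩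
    ((f ∘ suc ⊛ g) ⊛ h) n + ((f ⊛ g ∘ suc) ⊛ h) n + ((f ⊛ g) ⊛ h ∘ suc) n
      ≈⟨ +-assoc _ _ _ ⟩
    ((f ∘ suc ⊛ g) ⊛ h) n + (((f ⊛ g ∘ suc) ⊛ h) n + ((f ⊛ g) ⊛ h ∘ suc) n)
      ≈⟨ +-cong (⊛-assoc _ g h n) (+-cong (⊛-assoc f _ h n) (⊛-assoc f g _ n)) ⟩
    (f ∘ suc ⊛ (g ⊛ h)) n + ((f ⊛ (g ∘ suc ⊛ h)) n + (f ⊛ (g ⊛ h ∘ suc)) n)
      ≈⟨ +-congˡ (⊛-distribˡ f _ _ n) ⟨
    (f ∘ suc ⊛ (g ⊛ h)) n + (f ⊛ (g ⊛ h) ∘ suc) n ∎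

  ⊙-⊛-comm : ∀ a b f g n → ((a ⊙ f) ⊛ (b ⊙ g)) n ≈ (a * b) * (f ⊛ g) n
  ⊙-⊛-comm a b f g zero    = *-interchange _ _ _ _
  ⊙-⊛-comm a b f g (suc n) =
    trans (+-cong (⊙-⊛-comm a b _ g n) (⊙-⊛-comm a b f _ n)) (sym (distribˡ _ _ _))

  ⊛-⊙-comm : ∀ f a g n → (f ⊛ (a ⊙ g)) n ≈ a * (f ⊛ g) n
  ⊛-⊙-comm f a g zero    = x∙yz≈y∙xz _ _ _
  ⊛-⊙-comm f a g (suc n) =
    trans (+-cong (⊛-⊙-comm _ a g n) (⊛-⊙-comm f a _ n)) (sym (distribˡ _ _ _))

  ×-as-* : ∀ m x → m · x ≈ (m · 1#) * x
  ×-as-* m x = sym (trans (×-assoc-* m 1# x) (×-congʳ m (*-identityˡ x)))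

  ×-zeroʳ : ∀ m → m · 0# ≈ 0#
  ×-zeroʳ m = trans (×-as-* m 0#) (zeroʳ _)

  ⊛-×-comm : ∀ f m g n → (f ⊛ (λ k → m · g k)) n ≈ m · (f ⊛ g) n
  ⊛-×-comm f m g n = begin
    (f ⊛ (λ k → m · g k)) n  ≈⟨ ⊛-cong {f} (λ _ → refl) (λ k → ×-as-* m (g k)) n ⟩
    (f ⊛ ((m · 1#) ⊙ g)) n   ≈⟨ ⊛-⊙-comm f _ g n ⟩
    (m · 1#) * (f ⊛ g) n     ≈⟨ ×-as-* m _ ⟨
    m · (f ⊛ g) n            ∎

  ⊛-zeroˡ : ∀ f n → (𝟘 ⊛ f) n ≈ 0#
  ⊛-zeroˡ f zero    = zeroˡ _
  ⊛-zeroˡ f (suc n) = trans (+-cong (⊛-zeroˡ f n) (⊛-zeroˡ _ n)) (+-identityˡ _)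

  ⊛-identityˡ : ∀ f n → (𝟙 ⊛ f) n ≈ f n
  ⊛-identityˡ f zero    = *-identityˡ _
  ⊛-identityˡ f (suc n) = trans (+-cong (⊛-zeroˡ f n) (⊛-identityˡ _ n)) (+-identityˡ _)

  ⊛-distribˡ-sum : ∀ f {m} (g : Fin m → Series) n →
                   (f ⊛ (λ k → ∑[ i < m ] (g i k))) n ≈ ∑[ i < m ] (f ⊛ g i) n
  ⊛-distribˡ-sum f {zero}  g n = trans (⊛-comm f 𝟘 n) (⊛-zeroˡ f n)
  ⊛-distribˡ-sum f {suc m} g n =
    trans (⊛-distribˡ f _ _ n) (+-congˡ (⊛-distribˡ-sum f (g ∘ suc) n))

  ∏ : ℕ → (ℕ → Series) → Series
  ∏ zero    A = 𝟙
  ∏ (suc j) A = A 0 ⊛ ∏ j (A ∘ suc)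

  ∏-cong : ∀ j {A B} → (∀ {v} → v ℕ.< j → ∀ n → A v n ≈ B v n) → ∀ n → ∏ j A n ≈ ∏ j B n
  ∏-cong zero    A≈B n = refl
  ∏-cong (suc j) A≈B n = ⊛-cong (A≈B (s≤s z≤n)) (∏-cong j (A≈B ∘ s≤s)) n

  ∏-last : ∀ j A n → ∏ (suc j) A n ≈ (∏ j A ⊛ A j) n
  ∏-last zero    A n = ⊛-comm (A 0) 𝟙 n
  ∏-last (suc j) A n = begin
    (A 0 ⊛ ∏ (suc j) (A ∘ suc)) n          ≈⟨ ⊛-cong (λ _ → refl) (∏-last j (A ∘ suc)) n ⟩
    (A 0 ⊛ (∏ j (A ∘ suc) ⊛ A (suc j))) n  ≈⟨ ⊛-assoc (A 0) _ _ n ⟨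
    (A 0 ⊛ ∏ j (A ∘ suc) ⊛ A (suc j)) n    ∎

  ∏-⊛ : ∀ {u j} → u ℕ.< j → ∀ A B C n →
        ∏ j (A [ u ]≔ (B ⊛ C)) n ≈ (∏ j (A [ u ]≔ B) ⊛ C) n
  ∏-⊛ {zero} {suc j} _ A B C n = begin
    (B ⊛ C ⊛ ∏ j (A ∘ suc)) n    ≈⟨ ⊛-assoc B C _ n ⟩
    (B ⊛ (C ⊛ ∏ j (A ∘ suc))) n  ≈⟨ ⊛-cong (λ _ → refl) (⊛-comm C _) n ⟩
    (B ⊛ (∏ j (A ∘ suc) ⊛ C)) n  ≈⟨ ⊛-assoc B _ C n ⟨
    (B ⊛ ∏ j (A ∘ suc) ⊛ C) n    ∎
  ∏-⊛ {suc u} {suc j} (s≤s u<j) A B C n =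
    trans (⊛-cong (λ _ → refl) (∏-⊛ u<j (A ∘ suc) B C) n) (sym (⊛-assoc (A 0) _ C n))

  leibniz : ∀ j A n → ∏ j A (suc n) ≈ ∑[ u < j ] (∏ j (A [ toℕ u ]≔ (A (toℕ u) ∘ suc)) n)
  leibniz zero    A n = refl
  leibniz (suc j) A n = +-congˡ (begin
    (A 0 ⊛ ∏ j (A ∘ suc) ∘ suc) n
      ≈⟨ ⊛-cong {A 0} (λ _ → refl) (leibniz j (A ∘ suc)) n ⟩
    (A 0 ⊛ (λ k → ∑[ u < j ] (∏ j (A ∘ suc [ toℕ u ]≔ (A (suc (toℕ u)) ∘ suc)) k))) n
      ≈⟨ ⊛-distribˡ-sum (A 0) {j} _ n ⟩
    ∑[ u < j ] ((A 0 ⊛ ∏ j (A ∘ suc [ toℕ u ]≔ (A (suc (toℕ u)) ∘ suc))) n) ∎)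

  -- The divided power gᵏ/k! of a series g with zero constant term.
  dividedPower : Series → ℕ → Series
  dividedPower g zero    = 𝟙
  dividedPower g (suc k) zero    = 0#
  dividedPower g (suc k) (suc n) = (g ∘ suc ⊛ dividedPower g k) n

  taylor : ∀ (g : Series) (Y : ℕ → Series) → (∀ i n → Y i (suc n) ≈ (g ∘ suc ⊛ Y (suc i)) n) →
           ∀ N {n} → n ≤ N → ∀ i →
           Y i n ≈ ∑[ k ≤ N ] (Y (toℕ k ℕ.+ i) 0 * dividedPower g (toℕ k) n)
  taylor g Y ode N {zero} _ i = sym (begin
    Y i 0 * 1# + ∑[ k < N ] (Y (suc (toℕ k) ℕ.+ i) 0 * 0#)
      ≈⟨ +-cong (*-identityʳ _) (sum-cong-≋ {N} (λ k → zeroʳ (Y (suc (toℕ k) ℕ.+ i) 0))) ⟩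
    Y i 0 + ∑[ k < N ] 0#
      ≈⟨ +-congˡ (sum-replicate-zero N) ⟩
    Y i 0 + 0#
      ≈⟨ +-identityʳ _ ⟩
    Y i 0 ∎)
  taylor g Y ode (suc N) {suc n} (s≤s n≤N) i = begin
    Y i (suc n)
      ≈⟨ ode i n ⟩
    (g ∘ suc ⊛ Y (suc i)) n
      ≈⟨ ⊛-cong-≤ n (λ _ → refl) (λ {m} m≤n → taylor g Y ode N (ℕ.≤-trans m≤n n≤N) (suc i)) ⟩
    (g ∘ suc ⊛ (λ m → ∑[ k ≤ N ] (Y (toℕ k ℕ.+ suc i) 0 * dividedPower g (toℕ k) m))) n
      ≈⟨ ⊛-distribˡ-sum (g ∘ suc) {suc N} (λ k → Y (toℕ k ℕ.+ suc i) 0 ⊙ dividedPower g (toℕ k)) n ⟩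
    ∑[ k ≤ N ] ((g ∘ suc ⊛ (Y (toℕ k ℕ.+ suc i) 0 ⊙ dividedPower g (toℕ k))) n)
      ≈⟨ sum-cong-≋ {suc N} (λ k → trans (⊛-⊙-comm (g ∘ suc) _ (dividedPower g (toℕ k)) n)
           (*-congʳ (reflexive (≡.cong (λ j → Y j 0) (ℕ.+-suc (toℕ k) i))))) ⟩
    ∑[ k ≤ N ] (Y (suc (toℕ k) ℕ.+ i) 0 * dividedPower g (suc (toℕ k)) (suc n))
      ≈⟨ +-identityˡ _ ⟨
    0# + ∑[ k ≤ N ] (Y (suc (toℕ k) ℕ.+ i) 0 * dividedPower g (suc (toℕ k)) (suc n))
      ≈⟨ +-congʳ (zeroʳ _) ⟨
    ∑[ k ≤ suc N ] (Y (toℕ k ℕ.+ i) 0 * dividedPower g (toℕ k) (suc n)) ∎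

  scale : Carrier → Series → Series
  scale r f n = r ^ n * f n

  scale-⊛ : ∀ r f g n → (scale r f ⊛ scale r g) n ≈ scale r (f ⊛ g) n
  scale-⊛ r f g zero    = begin
    (1# * f 0) * (1# * g 0)  ≈⟨ *-cong (*-identityˡ _) (*-identityˡ _) ⟩
    f 0 * g 0                ≈⟨ *-identityˡ _ ⟨
    1# * (f 0 * g 0)         ∎
  scale-⊛ r f g (suc n) = begin
    (scale r f ∘ suc ⊛ scale r g) n + (scale r f ⊛ scale r g ∘ suc) n
      ≈⟨ +-cong (⊛-cong (scale-suc f) (λ _ → refl) n)
                (⊛-cong {scale r f} (λ _ → refl) (scale-suc g) n) ⟩
    ((r ⊙ scale r (f ∘ suc)) ⊛ scale r g) n + (scale r f ⊛ (r ⊙ scale r (g ∘ suc))) n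
      ≈⟨ +-cong (trans (⊛-comm (r ⊙ _) _ n)
                  (trans (⊛-⊙-comm (scale r g) r _ n) (*-congˡ (⊛-comm _ (scale r (f ∘ suc)) n))))
                (⊛-⊙-comm (scale r f) r _ n) ⟩
    r * (scale r (f ∘ suc) ⊛ scale r g) n + r * (scale r f ⊛ scale r (g ∘ suc)) n
      ≈⟨ +-cong (*-congˡ (scale-⊛ r _ g n)) (*-congˡ (scale-⊛ r f _ n)) ⟩
    r * (r ^ n * (f ∘ suc ⊛ g) n) + r * (r ^ n * (f ⊛ g ∘ suc) n)
      ≈⟨ +-cong (*-assoc _ _ _) (*-assoc _ _ _) ⟨
    r ^ suc n * (f ∘ suc ⊛ g) n + r ^ suc n * (f ⊛ g ∘ suc) n
      ≈⟨ distribˡ _ _ _ ⟨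
    r ^ suc n * (f ⊛ g) (suc n) ∎
    where
    scale-suc : ∀ h m → scale r h (suc m) ≈ r * scale r (h ∘ suc) m
    scale-suc h m = *-assoc _ _ _

  dividedPower-cong : ∀ {g h} → (∀ n → g n ≈ h n) → ∀ k n → dividedPower g k n ≈ dividedPower h k n
  dividedPower-cong g≈h zero    n       = refl
  dividedPower-cong g≈h (suc k) zero    = refl
  dividedPower-cong g≈h (suc k) (suc n) = ⊛-cong (g≈h ∘ suc) (dividedPower-cong g≈h k) n

  dividedPower-scale : ∀ r g k n → dividedPower (scale r g) k n ≈ scale r (dividedPower g k) n
  dividedPower-scale r g zero    zero    = sym (*-identityˡ _)
  dividedPower-scale r g zero    (suc n) = sym (zeroʳ _)
  dividedPower-scale r g (suc k) zero    = sym (zeroʳ _)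
  dividedPower-scale r g (suc k) (suc n) = begin
    (scale r g ∘ suc ⊛ dividedPower (scale r g) k) n
      ≈⟨ ⊛-cong (λ m → *-assoc r (r ^ m) _) (dividedPower-scale r g k) n ⟩
    ((r ⊙ scale r (g ∘ suc)) ⊛ scale r (dividedPower g k)) n
      ≈⟨ ⊛-comm (r ⊙ _) _ n ⟩
    (scale r (dividedPower g k) ⊛ (r ⊙ scale r (g ∘ suc))) n
      ≈⟨ ⊛-⊙-comm _ r _ n ⟩
    r * (scale r (dividedPower g k) ⊛ scale r (g ∘ suc)) n
      ≈⟨ *-congˡ (⊛-comm _ (scale r (g ∘ suc)) n) ⟩
    r * (scale r (g ∘ suc) ⊛ scale r (dividedPower g k)) n
      ≈⟨ *-congˡ (scale-⊛ r (g ∘ suc) _ n) ⟩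
    r * (r ^ n * (g ∘ suc ⊛ dividedPower g k) n)
      ≈⟨ *-assoc _ _ _ ⟨
    r ^ suc n * (g ∘ suc ⊛ dividedPower g k) n ∎

  taylorCoefficients : Series → Series
  taylorCoefficients f n = (n !) · f n

  private
    module PS = RawSemiring seriesSemiring
    module PSOps = RawSemiringDefs seriesSemiring

    θ : Series → Series
    θ f n = n · f n

  *-shiftʳ : ∀ f g → g 0 ≈ 0# → ∀ n → (f PS.* g) (suc n) ≈ (f PS.* (g ∘ suc)) n
  *-shiftʳ f g g₀≈0 zero    = +-congˡ (begin
    f 1 * g 0 + 0#  ≈⟨ +-congʳ (*-congˡ g₀≈0) ⟩
    f 1 * 0# + 0#   ≈⟨ +-identityʳ _ ⟩
    f 1 * 0#        ≈⟨ zeroʳ _ ⟩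
    0#              ∎)
  *-shiftʳ f g g₀≈0 (suc n) = +-congˡ (*-shiftʳ (f ∘ suc) g g₀≈0 n)

  sum-× : ∀ m {k} (t : Fin k → Carrier) → m · sum t ≈ ∑[ i < k ] (m · t i)
  sum-× m {zero}  t = ×-zeroʳ m
  sum-× m {suc k} t = trans (×-distrib-+ _ _ m) (+-congˡ (sum-× m (t ∘ suc)))

  θ-leibniz : ∀ f g n → n · (f PS.* g) n ≈ (θ f PS.* g) n + (f PS.* θ g) n
  θ-leibniz f g n = begin
    n · ∑[ k ≤ n ] (f (toℕ k) * g (n ∸ toℕ k))
      ≈⟨ sum-× n {suc n} (λ k → f (toℕ k) * g (n ∸ toℕ k)) ⟩
    ∑[ k ≤ n ] (n · (f (toℕ k) * g (n ∸ toℕ k)))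
      ≈⟨ sum-cong-≋ {suc n} (λ k → term (ℕ.≤-pred (Fin.toℕ<n k))) ⟩
    ∑[ k ≤ n ] (θ f (toℕ k) * g (n ∸ toℕ k) + f (toℕ k) * θ g (n ∸ toℕ k))
      ≈⟨ ∑-distrib-+ {suc n} (λ k → θ f (toℕ k) * g (n ∸ toℕ k))
                             (λ k → f (toℕ k) * θ g (n ∸ toℕ k)) ⟩
    (θ f PS.* g) n + (f PS.* θ g) n ∎
    where
    term : ∀ {k} → k ≤ n → n · (f k * g (n ∸ k)) ≈ θ f k * g (n ∸ k) + f k * θ g (n ∸ k)
    term {k} k≤n = begin
      n · (f k * g (n ∸ k))
        ≈⟨ ×-congˡ (ℕ.m+[n∸m]≡n k≤n) ⟨
      (k ℕ.+ (n ∸ k)) · (f k * g (n ∸ k))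
        ≈⟨ ×-homo-+ _ k (n ∸ k) ⟩
      k · (f k * g (n ∸ k)) + (n ∸ k) · (f k * g (n ∸ k))
        ≈⟨ +-cong (×-assoc-* k _ _) (×-comm-* (n ∸ k) _ _) ⟨
      θ f k * g (n ∸ k) + f k * θ g (n ∸ k) ∎

  taylorCoefficients-suc : ∀ f n → taylorCoefficients f (suc n) ≈ taylorCoefficients (θ f ∘ suc) n
  taylorCoefficients-suc f n =
    trans (×-congˡ (ℕ.*-comm (suc n) (n !))) (sym (×-assocˡ (f (suc n)) (n !) (suc n)))

  taylorCoefficients-* : ∀ f g n →
    taylorCoefficients (f PS.* g) n ≈ (taylorCoefficients f ⊛ taylorCoefficients g) n
  taylorCoefficients-* f g zero    = begin
    1 · (f 0 * g 0 + 0#)     ≈⟨ ×-homo-1 _ ⟩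
    f 0 * g 0 + 0#           ≈⟨ +-identityʳ _ ⟩
    f 0 * g 0                ≈⟨ *-cong (×-homo-1 _) (×-homo-1 _) ⟨
    (1 · f 0) * (1 · g 0)    ∎
  taylorCoefficients-* f g (suc n) = begin
    taylorCoefficients (f PS.* g) (suc n)
      ≈⟨ taylorCoefficients-suc (f PS.* g) n ⟩
    (n !) · (suc n · (f PS.* g) (suc n))
      ≈⟨ ×-congʳ (n !) (θ-leibniz f g (suc n)) ⟩
    (n !) · ((0# * g (suc n) + (θ f ∘ suc PS.* g) n) + (f PS.* θ g) (suc n))
      ≈⟨ ×-congʳ (n !) (+-cong (trans (+-congʳ (zeroˡ _)) (+-identityˡ _))
                               (*-shiftʳ f (θ g) refl n)) ⟩
    (n !) · ((θ f ∘ suc PS.* g) n + (f PS.* θ g ∘ suc) n)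
      ≈⟨ ×-distrib-+ _ _ (n !) ⟩
    taylorCoefficients (θ f ∘ suc PS.* g) n + taylorCoefficients (f PS.* θ g ∘ suc) n
      ≈⟨ +-cong (taylorCoefficients-* _ g n) (taylorCoefficients-* f _ n) ⟩
    (taylorCoefficients (θ f ∘ suc) ⊛ taylorCoefficients g) n +
    (taylorCoefficients f ⊛ taylorCoefficients (θ g ∘ suc)) n
      ≈⟨ +-cong (⊛-cong (taylorCoefficients-suc f) (λ _ → refl) n)
                (⊛-cong {taylorCoefficients f} (λ _ → refl) (taylorCoefficients-suc g) n) ⟨
    (taylorCoefficients f ⊛ taylorCoefficients g) (suc n) ∎

  dividedPower-suc : ∀ g k → g 0 ≈ 0# → ∀ n →
    (g ⊛ dividedPower g k) n ≈ suc k · dividedPower g (suc k) n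
  dividedPower-suc g k       g₀≈0 zero    = begin
    g 0 * dividedPower g k 0  ≈⟨ *-congʳ g₀≈0 ⟩
    0# * dividedPower g k 0   ≈⟨ zeroˡ _ ⟩
    0#                        ≈⟨ ×-zeroʳ (suc k) ⟨
    suc k · 0#                ∎
  dividedPower-suc g zero    g₀≈0 (suc n) = +-congˡ (trans (⊛-comm g 𝟘 n) (⊛-zeroˡ g n))
  dividedPower-suc g (suc k) g₀≈0 (suc n) = +-congˡ (begin
    (g ⊛ (g ∘ suc ⊛ dividedPower g k)) n        ≈⟨ ⊛-assoc g _ _ n ⟨
    (g ⊛ g ∘ suc ⊛ dividedPower g k) n          ≈⟨ ⊛-cong (⊛-comm g _) (λ _ → refl) n ⟩
    (g ∘ suc ⊛ g ⊛ dividedPower g k) n          ≈⟨ ⊛-assoc (g ∘ suc) g _ n ⟩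
    (g ∘ suc ⊛ (g ⊛ dividedPower g k)) n
      ≈⟨ ⊛-cong {g ∘ suc} (λ _ → refl) (dividedPower-suc g k g₀≈0) n ⟩
    (g ∘ suc ⊛ (λ m → suc k · dividedPower g (suc k) m)) n
      ≈⟨ ⊛-×-comm (g ∘ suc) (suc k) _ n ⟩
    suc k · (g ∘ suc ⊛ dividedPower g (suc k)) n ∎)

  taylorCoefficients-^ : ∀ f → f 0 ≈ 0# → ∀ k n →
    taylorCoefficients (f PSOps.^ k) n ≈ (k !) · dividedPower (taylorCoefficients f) k n
  taylorCoefficients-^ f f₀≈0 zero    zero    = refl
  taylorCoefficients-^ f f₀≈0 zero    (suc n) = trans (×-zeroʳ (suc n !)) (sym (+-identityʳ _))
  taylorCoefficients-^ f f₀≈0 (suc k) n = begin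
    taylorCoefficients (f PS.* f PSOps.^ k) n
      ≈⟨ taylorCoefficients-* f _ n ⟩
    (taylorCoefficients f ⊛ taylorCoefficients (f PSOps.^ k)) n
      ≈⟨ ⊛-cong {taylorCoefficients f} (λ _ → refl) (taylorCoefficients-^ f f₀≈0 k) n ⟩
    (taylorCoefficients f ⊛ (λ m → (k !) · dividedPower (taylorCoefficients f) k m)) n
      ≈⟨ ⊛-×-comm (taylorCoefficients f) (k !) _ n ⟩
    (k !) · (taylorCoefficients f ⊛ dividedPower (taylorCoefficients f) k) n
      ≈⟨ ×-congʳ (k !) (dividedPower-suc _ k (trans (×-homo-1 _) f₀≈0) n) ⟩
    (k !) · (suc k · dividedPower (taylorCoefficients f) (suc k) n)
      ≈⟨ ×-assocˡ _ (k !) (suc k) ⟩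
    ((k !) ℕ.* suc k) · dividedPower (taylorCoefficients f) (suc k) n
      ≈⟨ ×-congˡ (ℕ.*-comm (k !) (suc k)) ⟩
    ((suc k) !) · dividedPower (taylorCoefficients f) (suc k) n ∎

  *t-^-suc : ∀ a k n → ((a *t) PSOps.^ suc k) (suc n) ≈ a * ((a *t) PSOps.^ k) n
  *t-^-suc a k n = begin
    0# * g (suc n) + (a * g n + ∑[ j < n ] (0# * g (n ∸ suc (toℕ j))))
      ≈⟨ +-cong (zeroˡ _) (+-congˡ (sum-cong-≋ {n} (λ j → zeroˡ (g (n ∸ suc (toℕ j)))))) ⟩
    0# + (a * g n + ∑[ j < n ] 0#)
      ≈⟨ +-identityˡ _ ⟩
    a * g n + ∑[ j < n ] 0#
      ≈⟨ +-congˡ (sum-replicate-zero n) ⟩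
    a * g n + 0#
      ≈⟨ +-identityʳ _ ⟩
    a * g n ∎
    where
    g = (a *t) PSOps.^ k

  ⟨*t⟩ : ∀ f a n → (f ⟨ a *t ⟩) n ≈ f n * a ^ n
  ⟨*t⟩ f a zero    = +-identityʳ _
  ⟨*t⟩ f a (suc n) = begin
    f 0 * 0# + ∑[ k ≤ n ] (f (suc (toℕ k)) * ((a *t) PSOps.^ suc (toℕ k)) (suc n))
      ≈⟨ trans (+-congʳ (zeroʳ _)) (+-identityˡ _) ⟩
    ∑[ k ≤ n ] (f (suc (toℕ k)) * ((a *t) PSOps.^ suc (toℕ k)) (suc n))
      ≈⟨ sum-cong-≋ {suc n} (λ k → trans
           (*-congˡ {f (suc (toℕ k))} (*t-^-suc a (toℕ k) n))
           (x∙yz≈y∙xz (f (suc (toℕ k))) a _)) ⟩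
    ∑[ k ≤ n ] (a * (f (suc (toℕ k)) * ((a *t) PSOps.^ toℕ k) n))
      ≈⟨ *-distribˡ-sum {suc n} a (λ k → f (suc (toℕ k)) * ((a *t) PSOps.^ toℕ k) n) ⟨
    a * ((f ∘ suc) ⟨ a *t ⟩) n
      ≈⟨ *-congˡ (⟨*t⟩ (f ∘ suc) a n) ⟩
    a * (f (suc n) * a ^ n)
      ≈⟨ x∙yz≈y∙xz _ _ _ ⟩
    f (suc n) * a ^ suc n ∎

  taylorCoefficients-⟨⟩ : ∀ f g → g 0 ≈ 0# → ∀ n → taylorCoefficients (f ⟨ g ⟩) n ≈
    ∑[ k ≤ n ] (taylorCoefficients f (toℕ k) * dividedPower (taylorCoefficients g) (toℕ k) n)
  taylorCoefficients-⟨⟩ f g g₀≈0 n = trans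
    (sum-× (n !) {suc n} (λ k → f (toℕ k) * (g PSOps.^ toℕ k) n))
    (sum-cong-≋ {suc n} (λ k → term (toℕ k)))
    where
    term : ∀ k → (n !) · (f k * (g PSOps.^ k) n) ≈
           taylorCoefficients f k * dividedPower (taylorCoefficients g) k n
    term k = begin
      (n !) · (f k * (g PSOps.^ k) n)          ≈⟨ ×-comm-* (n !) _ _ ⟨
      f k * taylorCoefficients (g PSOps.^ k) n ≈⟨ *-congˡ (taylorCoefficients-^ g g₀≈0 k n) ⟩
      f k * ((k !) · d)                        ≈⟨ ×-comm-* (k !) _ _ ⟩
      (k !) · (f k * d)                        ≈⟨ ×-assoc-* (k !) _ _ ⟨
      taylorCoefficients f k * d               ∎
      where
      d = dividedPower (taylorCoefficients g) k n

  ×-cancelˡ : ∀ m {u} → m · u ≈ 1# → ∀ {x y} → m · x ≈ m · y → x ≈ y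
  ×-cancelˡ m {u} mu≈1 {x} {y} eq = begin
    x            ≈⟨ divide x ⟩
    u * (m · x)  ≈⟨ *-congˡ eq ⟩
    u * (m · y)  ≈⟨ divide y ⟨
    y            ∎
    where
    divide : ∀ z → z ≈ u * (m · z)
    divide z = begin
      z            ≈⟨ *-identityˡ z ⟨
      1# * z       ≈⟨ *-congʳ mu≈1 ⟨
      (m · u) * z  ≈⟨ ×-assoc-* m u z ⟩
      m · (u * z)  ≈⟨ ×-comm-* m u z ⟨
      u * (m · z)  ∎

  inverse-^ : ∀ {r s} → s * r ≈ 1# → ∀ n → s ^ n * r ^ n ≈ 1#
  inverse-^ sr≈1 zero    = *-identityˡ 1#
  inverse-^ sr≈1 (suc n) =
    trans (*-interchange _ _ _ _) (trans (*-cong sr≈1 (inverse-^ sr≈1 n)) (*-identityˡ 1#))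

-- Parent maps

-- The vector lists the parents of the vertices j, j + 1, ….
data Attaches {N} : ∀ {m} → ℕ → Vec (Maybe (Fin N)) m → Set where
  []  : ∀ {j} → Attaches j []
  _∷_ : ∀ {j m u} {T : Vec _ m} → toℕ u ℕ.< j → Attaches (suc j) T → Attaches j (just u ∷ T)

HasIndex : ∀ {N} → ℕ → Maybe (Fin N) → Set
HasIndex v x = Maybe.map toℕ x ≡ just v

hasIndex? : ∀ {N} v (x : Maybe (Fin N)) → Dec (HasIndex v x)
hasIndex? v x = Maybe.≡-dec ℕ._≟_ (Maybe.map toℕ x) (just v)

childCount : ∀ {N m} → ℕ → Vec (Maybe (Fin N)) m → ℕ
childCount v = Vec.count (hasIndex? v)

count-yes : ∀ {a p} {A : Set a} {P : A → Set p} (P? : ∀ x → Dec (P x)) {x n} {xs : Vec A n} →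
            P x → Vec.count P? (x ∷ xs) ≡ suc (Vec.count P? xs)
count-yes P? {x} px with P? x
... | yes _  = ≡.refl
... | no ¬px = contradiction px ¬px

count-no : ∀ {a p} {A : Set a} {P : A → Set p} (P? : ∀ x → Dec (P x)) {x n} {xs : Vec A n} →
           ¬ P x → Vec.count P? (x ∷ xs) ≡ Vec.count P? xs
count-no P? {x} ¬px with P? x
... | yes px = contradiction px ¬px
... | no  _  = ≡.refl

childCount-∷ : ∀ {N m} (c : ℕ → ℕ) (u : Fin N) (T : Vec (Maybe (Fin N)) m) v →
  c v ℕ.+ childCount v (just u ∷ T) ≡ (c [ toℕ u ]≔ suc (c (toℕ u))) v ℕ.+ childCount v T
childCount-∷ c u T v with toℕ u ℕ.≟ v
... | yes ≡.refl = ≡.trans (≡.cong (c v ℕ.+_) (count-yes (hasIndex? v) {xs = T} ≡.refl))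
  (≡.trans (ℕ.+-suc _ _) (≡.cong (ℕ._+ childCount v T) (≡.sym ([]≔-updated c v))))
... | no  u≢v    = ≡.cong₂ ℕ._+_ (≡.sym ([]≔-minimal c (u≢v ∘ ≡.sym)))
  (count-no (hasIndex? v) {xs = T} (u≢v ∘ Maybe.just-injective))

attaches⇒lookup : ∀ {N m j} {T : Vec (Maybe (Fin N)) m} → Attaches j T →
  ∀ i → ∃ λ u → lookup T i ≡ just u × toℕ u ℕ.< j ℕ.+ toℕ i
attaches⇒lookup {j = j} (_∷_ {u = u} u<j att) zero = u , ≡.refl , ℕ.≤-trans u<j (ℕ.m≤m+n j 0)
attaches⇒lookup {j = j} (_ ∷ att) (suc i) with u , eq , u< ← attaches⇒lookup att i =
  u , eq , ≡.subst (toℕ u ℕ.<_) (≡.sym (ℕ.+-suc j (toℕ i))) u<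

lookup⇒attaches : ∀ {N m} j (T : Vec (Maybe (Fin N)) m) →
  (∀ i → ∃ λ u → lookup T i ≡ just u × toℕ u ℕ.< j ℕ.+ toℕ i) → Attaches j T
lookup⇒attaches j []      att = []
lookup⇒attaches j (x ∷ T) att with u , ≡.refl , u< ← att zero =
  ≡.subst (toℕ u ℕ.<_) (ℕ.+-identityʳ j) u< ∷ lookup⇒attaches (suc j) T λ i →
    let u , eq , u< = att (suc i) in u , eq , ≡.subst (toℕ u ℕ.<_) (ℕ.+-suc j (toℕ i)) u<

module _ {n} (T : ParentMap n) where

  ancestor-suc : ∀ k {v u} → parent T v ≡ just u → ancestor T (suc k) v ≡ ancestor T k u
  ancestor-suc k eq = ≡.cong (_>>= ancestor T k) eq

  ancestor-suc-root : ∀ k {r} → parent T r ≡ nothing → ancestor T (suc k) r ≡ nothing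
  ancestor-suc-root k eq = ≡.cong (_>>= ancestor T k) eq

  ancestor-of-root : ∀ k {v r} → parent T v ≡ nothing → ancestor T k v ≡ just r → v ≡ r
  ancestor-of-root zero    _  eq = Maybe.just-injective eq
  ancestor-of-root (suc k) pv eq = contradiction (≡.trans (≡.sym (ancestor-suc-root k pv)) eq) λ ()

  height-unique : ∀ {r} → parent T r ≡ nothing → ∀ k l {v} →
    ancestor T k v ≡ just r → ancestor T l v ≡ just r → k ≡ l
  height-unique root zero    zero    _      _  = ≡.refl
  height-unique root zero    (suc l) ≡.refl eq =
    contradiction (≡.trans (≡.sym (ancestor-suc-root l root)) eq) λ ()
  height-unique root (suc k) zero    eq ≡.refl =
    contradiction (≡.trans (≡.sym (ancestor-suc-root k root)) eq) λ ()
  height-unique root (suc k) (suc l) {v} eqₖ eqₗ with parent T v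
  ... | just u = ≡.cong suc (height-unique root k l eqₖ eqₗ)

module _ {n} (t : IncreasingTree n) where
  private
    T = proj₁ t

  height-child : ∀ {v u} → parent T v ≡ just u → height t v ≡ suc (height t u)
  height-child {v} {u} eq = let _ , _ , r , pr , path = t in
    height-unique T pr _ _ (proj₂ (path v))
      (≡.trans (ancestor-suc T (proj₁ (path u)) eq) (proj₂ (path u)))

  height-root : ∀ {v} → parent T v ≡ nothing → height t v ≡ 0
  height-root {v} eq = let _ , _ , r , pr , path = t in
    height-unique T pr _ 0 (proj₂ (path v))
      (≡.cong just (ancestor-of-root T (proj₁ (path v)) eq (proj₂ (path v))))

module _ {n} {T : Vec (Maybe (Fin (suc n))) n} where

  attaches⇒tree : Attaches 1 T → IsIncreasingTree (nothing ∷ T)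
  attaches⇒tree att = increasing , zero , ≡.refl , λ v → path v (<-wellFounded v)
    where
    increasing : IsIncreasing (nothing ∷ T)
    increasing zero    = nothing
    increasing (suc i) with u , eq , u< ← attaches⇒lookup att i =
      ≡.subst (MaybeAll.All (Fin._< suc i)) (≡.sym eq) (just {x = u} u<)

    path : ∀ v → Acc Fin._<_ v → ∃ λ k → ancestor (nothing ∷ T) k v ≡ just zero
    path zero    _         = 0 , ≡.refl
    path (suc i) (acc rec) with u , eq , u< ← attaches⇒lookup att i
      with k , eqₖ ← path u (rec u<) = suc k , ≡.trans (ancestor-suc (nothing ∷ T) k {suc i} eq) eqₖ

  tree⇒attaches : ∀ {x} → IsIncreasingTree (x ∷ T) → x ≡ nothing × Attaches 1 T
  tree⇒attaches {x} (inc , r , _ , path) = x≡nothing , lookup⇒attaches 1 T attached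
    where
    none-below-zero : ∀ {y : Maybe (Fin (suc n))} → MaybeAll.All (Fin._< zero {n}) y → y ≡ nothing
    none-below-zero nothing   = ≡.refl
    none-below-zero (just ())

    x≡nothing : x ≡ nothing
    x≡nothing = none-below-zero (inc zero)

    isRoot : ∀ v → parent (x ∷ T) v ≡ nothing → v ≡ r
    isRoot v eq = ancestor-of-root (x ∷ T) (proj₁ (path v)) eq (proj₂ (path v))

    attached : ∀ i → ∃ λ u → lookup T i ≡ just u × toℕ u ℕ.< 1 ℕ.+ toℕ i
    attached i with lookup T i in eq | inc (suc i)
    ... | just u  | just u< = u , ≡.refl , u<
    ... | nothing | _       =
      contradiction (≡.trans (isRoot zero x≡nothing) (≡.sym (isRoot (suc i) eq))) λ ()

length-filter : ∀ {a p q} {A : Set a} {B : Set} {P : A → Set p} {Q : B → Set q}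
  (P? : ∀ x → Dec (P x)) (Q? : ∀ y → Dec (Q y)) {n} (f : Fin n → B) (xs : Vec A n) →
  (∀ i → Q (f i) → P (lookup xs i)) → (∀ i → P (lookup xs i) → Q (f i)) →
  length (filter Q? (List.tabulate f)) ≡ Vec.count P? xs
length-filter P? Q? f []       Q⇒P P⇒Q = ≡.refl
length-filter P? Q? f (x ∷ xs) Q⇒P P⇒Q with Q? (f zero) | P? x
... | yes _ | yes _ = ≡.cong suc (length-filter P? Q? (f ∘ suc) xs (Q⇒P ∘ suc) (P⇒Q ∘ suc))
... | no  _ | no  _ = length-filter P? Q? (f ∘ suc) xs (Q⇒P ∘ suc) (P⇒Q ∘ suc)
... | yes q | no ¬p = contradiction (Q⇒P zero q) ¬p
... | no ¬q | yes p = contradiction (P⇒Q zero p) ¬q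

length-children : ∀ {n} (T : ParentMap n) v → length (children T v) ≡ childCount (toℕ v) T
length-children T v = length-filter (hasIndex? (toℕ v)) _ (λ u → u) T
  (λ i eq → ≡.cong (Maybe.map toℕ) eq) (λ i → Maybe.map-injective Fin.toℕ-injective)

extend : ∀ {n} → (Fin n → ℕ) → ℕ → ℕ
extend {zero}  f _       = 0
extend {suc n} f zero    = f zero
extend {suc n} f (suc v) = extend (f ∘ suc) v

extend-toℕ : ∀ {n} (f : Fin n → ℕ) i → extend f (toℕ i) ≡ f i
extend-toℕ f zero    = ≡.refl
extend-toℕ f (suc i) = extend-toℕ (f ∘ suc) i

-- Growing trees

module Insertion {c ℓ} (K : CommutativeSemiring c ℓ)
  (w : ℕ → ℕ → CommutativeSemiring.Carrier K) where
  open CommutativeSemiring K hiding (zero)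
  open SemiringSum semiring
  open SemiringMult semiring using (×-congʳ; ×-assoc-*) renaming (_×_ to _·_)
  open SemiringExp semiring using (_^_)
  open CommutativeSemigroupProperties *-commutativeSemigroup
    using (x∙yz≈y∙xz) renaming (interchange to *-interchange)
  open SetoidReasoning setoid
  open HurwitzSeries K
  open Defs.PowerSeries rawSemiring using (Series; ∂; _⟨_⟩; _*t)

  private
    -- X i h ′ = X (suc i) h ⊛ X 0 (suc h) is not structurally recursive, so it is unrolled
    -- N times, which is exact for the coefficients of index at most N.
    approximation : ℕ → ℕ → ℕ → Series
    approximation N       i h zero    = w i h
    approximation zero    i h (suc n) = 0#
    approximation (suc N) i h (suc n) = (approximation N (suc i) h ⊛ approximation N 0 (suc h)) n

    approximation-stable : ∀ {M N n} → n ≤ M → n ≤ N → ∀ i h →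
      approximation M i h n ≈ approximation N i h n
    approximation-stable {n = zero}  _         _         i h = refl
    approximation-stable {n = suc n} (s≤s n≤M) (s≤s n≤N) i h = ⊛-cong-≤ n
      (λ m≤n → approximation-stable (ℕ.≤-trans m≤n n≤M) (ℕ.≤-trans m≤n n≤N) (suc i) h)
      (λ m≤n → approximation-stable (ℕ.≤-trans m≤n n≤M) (ℕ.≤-trans m≤n n≤N) 0 (suc h))

    approximation-shift : ∀ {r} → (∀ i h → w i (suc h) ≈ r * w i h) → ∀ N i h n →
      approximation N i (suc h) n ≈ r * scale r (approximation N i h) n
    approximation-shift w-shift N       i h zero    =
      trans (w-shift i h) (*-congˡ (sym (*-identityˡ _)))
    approximation-shift w-shift zero    i h (suc n) = sym (trans (*-congˡ (zeroʳ _)) (zeroʳ _))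
    approximation-shift {r} w-shift (suc N) i h (suc n) = begin
      (approximation N (suc i) (suc h) ⊛ approximation N 0 (suc (suc h))) n
        ≈⟨ ⊛-cong (approximation-shift w-shift N (suc i) h)
                  (approximation-shift w-shift N 0 (suc h)) n ⟩
      ((r ⊙ scale r f) ⊛ (r ⊙ scale r g)) n  ≈⟨ ⊙-⊛-comm r r _ _ n ⟩
      (r * r) * (scale r f ⊛ scale r g) n    ≈⟨ *-congˡ (scale-⊛ r f g n) ⟩
      (r * r) * (r ^ n * (f ⊛ g) n)          ≈⟨ *-assoc _ _ _ ⟩
      r * (r * (r ^ n * (f ⊛ g) n))          ≈⟨ *-congˡ (*-assoc _ _ _) ⟨
      r * (r ^ suc n * (f ⊛ g) n)            ∎
      where
      f = approximation N (suc i) h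
      g = approximation N 0 (suc h)

  X : ℕ → ℕ → Series
  X i h n = approximation n i h n

  X-suc : ∀ i h n → X i h (suc n) ≈ (X (suc i) h ⊛ X 0 (suc h)) n
  X-suc i h n = ⊛-cong-≤ n (λ m≤n → approximation-stable m≤n ℕ.≤-refl (suc i) h)
                           (λ m≤n → approximation-stable m≤n ℕ.≤-refl 0 (suc h))

  X-shift : ∀ {r} → (∀ i h → w i (suc h) ≈ r * w i h) → ∀ i h n →
    X i (suc h) n ≈ r * scale r (X i h) n
  X-shift w-shift i h n = approximation-shift w-shift n i h n

  treeSeries : Series
  treeSeries zero    = 0#
  treeSeries (suc n) = X 0 0 n

  treeSeries-derivative : ∀ {r} → (∀ i h → w i (suc h) ≈ r * w i h) → ∀ n →
    X 0 0 n ≈ r ^ n * ∑[ k ≤ n ] (w (toℕ k) 0 * dividedPower treeSeries (toℕ k) n)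
  treeSeries-derivative {r} w-shift n = begin
    X 0 0 n
      ≈⟨ taylor (scale r treeSeries) (λ i → X i 0) ode n ℕ.≤-refl 0 ⟩
    ∑[ k ≤ n ] (w (toℕ k ℕ.+ 0) 0 * dividedPower (scale r treeSeries) (toℕ k) n)
      ≈⟨ sum-cong-≋ {suc n} (λ k → trans
           (*-cong (reflexive (≡.cong (λ i → w i 0) (ℕ.+-identityʳ (toℕ k))))
                   (dividedPower-scale r treeSeries (toℕ k) n))
           (x∙yz≈y∙xz _ _ _)) ⟩
    ∑[ k ≤ n ] (r ^ n * (w (toℕ k) 0 * dividedPower treeSeries (toℕ k) n))
      ≈⟨ *-distribˡ-sum {suc n} (r ^ n) (λ k → w (toℕ k) 0 * dividedPower treeSeries (toℕ k) n) ⟨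
    r ^ n * ∑[ k ≤ n ] (w (toℕ k) 0 * dividedPower treeSeries (toℕ k) n) ∎
    where
    ode : ∀ i n → X i 0 (suc n) ≈ (scale r treeSeries ∘ suc ⊛ X (suc i) 0) n
    ode i n = begin
      X i 0 (suc n)                              ≈⟨ X-suc i 0 n ⟩
      (X (suc i) 0 ⊛ X 0 1) n                    ≈⟨ ⊛-comm _ (X 0 1) n ⟩
      (X 0 1 ⊛ X (suc i) 0) n
        ≈⟨ ⊛-cong (λ m → trans (X-shift w-shift 0 0 m) (sym (*-assoc r (r ^ m) _))) (λ _ → refl) n ⟩
      (scale r treeSeries ∘ suc ⊛ X (suc i) 0) n ∎

  vertexProduct : ℕ → (c h : ℕ → ℕ) → Series
  vertexProduct j c h = ∏ j (λ v → X (c v) (h v))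

  -- The vertices v < j are placed, at height h v and with c v children so far; T lists the
  -- parents of the vertices j, j + 1, ….
  insert : ∀ {N m} → ℕ → (c h : ℕ → ℕ) → Vec (Maybe (Fin N)) m → Carrier
  insert j c h []            = vertexProduct j c h 0
  insert j c h (nothing ∷ T) = 0#
  insert j c h (just u ∷ T) with toℕ u ℕ.<? j
  ... | yes _ = insert (suc j) (c [ toℕ u ]≔ suc (c (toℕ u))) (h [ j ]≔ suc (h (toℕ u))) T
  ... | no  _ = 0#

  insert-invalid : ∀ {N m} j c h (T : Vec (Maybe (Fin N)) m) → ¬ Attaches j T → insert j c h T ≈ 0#
  insert-invalid j c h []            ¬att = contradiction [] ¬att
  insert-invalid j c h (nothing ∷ T) ¬att = refl
  insert-invalid j c h (just u ∷ T)  ¬att with toℕ u ℕ.<? j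
  ... | yes u<j = insert-invalid (suc j) _ _ T (¬att ∘ (u<j ∷_))
  ... | no  _   = refl

  insert-valid : ∀ {N m} j c h {T : Vec (Maybe (Fin N)) m} → Attaches j T →
    (H : ℕ → ℕ) → (∀ {v} → v ℕ.< j → H v ≡ h v) →
    (∀ i {u} → lookup T i ≡ just u → H (j ℕ.+ toℕ i) ≡ suc (H (toℕ u))) →
    insert j c h T ≈ vertexProduct (j ℕ.+ m) (λ v → c v ℕ.+ childCount v T) H 0
  insert-valid j c h [] H H-old H-new rewrite ℕ.+-identityʳ j =
    ∏-cong j (λ {v} v<j n → reflexive (≡.cong₂ (λ i k → X i k n)
      (≡.sym (ℕ.+-identityʳ (c v))) (≡.sym (H-old v<j)))) 0
  insert-valid {m = suc m} j c h {just u ∷ T} (u<j ∷ att) H H-old H-new with toℕ u ℕ.<? j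
  ... | no  u≮j = contradiction u<j u≮j
  ... | yes _ rewrite ℕ.+-suc j m = trans
    (insert-valid (suc j) _ _ att H H-old′
      (λ i eq → ≡.trans (≡.cong H (≡.sym (ℕ.+-suc j (toℕ i)))) (H-new (suc i) eq)))
    (∏-cong (suc (j ℕ.+ m)) (λ {v} _ n →
      reflexive (≡.cong (λ i → X i (H v) n) (≡.sym (childCount-∷ c u T v)))) 0)
    where
    H-old′ : ∀ {v} → v ℕ.< suc j → H v ≡ (h [ j ]≔ suc (h (toℕ u))) v
    H-old′ {v} v<1+j with v ℕ.≟ j
    ... | yes ≡.refl = ≡.trans (≡.cong H (≡.sym (ℕ.+-identityʳ j)))
      (≡.trans (H-new zero ≡.refl) (≡.trans (≡.cong suc (H-old u<j)) (≡.sym ([]≔-updated h j))))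
    ... | no  v≢j    = ≡.trans (H-old (ℕ.≤∧≢⇒< (ℕ.≤-pred v<1+j) v≢j)) (≡.sym ([]≔-minimal h v≢j))

  sumMap : ∀ {a} {A : Set a} → (A → Carrier) → List A → Carrier
  sumMap f xs = foldr _+_ 0# (List.map f xs)

  sumMap-++ : ∀ {a} {A : Set a} (f : A → Carrier) xs ys →
    sumMap f (xs ++ ys) ≈ sumMap f xs + sumMap f ys
  sumMap-++ f []       ys = sym (+-identityˡ _)
  sumMap-++ f (x ∷ xs) ys = trans (+-congˡ (sumMap-++ f xs ys)) (sym (+-assoc _ _ _))

  sumMap-0 : ∀ {a} {A : Set a} {f : A → Carrier} → (∀ x → f x ≈ 0#) → ∀ xs → sumMap f xs ≈ 0#
  sumMap-0 f≈0 []       = refl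
  sumMap-0 f≈0 (x ∷ xs) = trans (+-cong (f≈0 x) (sumMap-0 f≈0 xs)) (+-identityˡ _)

  sumMap-map : ∀ {a b} {A : Set a} {B : Set b} (f : B → Carrier) (g : A → B) xs →
    sumMap f (List.map g xs) ≡ sumMap (f ∘ g) xs
  sumMap-map f g xs = ≡.cong (foldr _+_ 0#) (≡.sym (List.map-∘ xs))

  sumMap-cartesianProductWith : ∀ {a b c} {A : Set a} {B : Set b} {C : Set c}
    (f : C → Carrier) (g : A → B → C) xs ys →
    sumMap f (cartesianProductWith g xs ys) ≈ sumMap (λ x → sumMap (f ∘ g x) ys) xs
  sumMap-cartesianProductWith f g []       ys = refl
  sumMap-cartesianProductWith f g (x ∷ xs) ys = trans (sumMap-++ f (List.map (g x) ys) _)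
    (+-cong (reflexive (sumMap-map f (g x) ys)) (sumMap-cartesianProductWith f g xs ys))

  sumMap-mapMaybe : ∀ {a b} {A : Set a} {B : Set b}
    (f : B → Carrier) (g : A → Maybe B) (h : A → Carrier) →
    (∀ x → Maybe.maybe f 0# (g x) ≈ h x) → ∀ xs → sumMap f (mapMaybe g xs) ≈ sumMap h xs
  sumMap-mapMaybe f g h eq []       = refl
  sumMap-mapMaybe f g h eq (x ∷ xs) with g x | eq x
  ... | just y  | eqx = +-cong eqx (sumMap-mapMaybe f g h eq xs)
  ... | nothing | eqx =
    trans (sumMap-mapMaybe f g h eq xs) (trans (sym (+-identityˡ _)) (+-congʳ eqx))

  sumMap-tabulate : ∀ {a} {A : Set a} (f : A → Carrier) {n} (g : Fin n → A) →
    sumMap f (List.tabulate g) ≈ sum (f ∘ g)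
  sumMap-tabulate f {zero}  g = refl
  sumMap-tabulate f {suc n} g = +-congˡ (sumMap-tabulate f (g ∘ suc))

  sum-restrict : ∀ {j N} → j ≤ N → (s : Fin N → Carrier) (t : ℕ → Carrier) →
    (∀ u → toℕ u ℕ.< j → s u ≈ t (toℕ u)) → (∀ u → ¬ toℕ u ℕ.< j → s u ≈ 0#) →
    sum s ≈ ∑[ u < j ] t (toℕ u)
  sum-restrict {N = N} z≤n s t s≈t s≈0 =
    trans (sum-cong-≋ (λ u → s≈0 u λ ())) (sum-replicate-zero N)
  sum-restrict (s≤s j≤N) s t s≈t s≈0 = +-cong (s≈t zero (s≤s z≤n))
    (sum-restrict j≤N (s ∘ suc) (t ∘ suc)
      (λ u → s≈t (suc u) ∘ s≤s) (λ u u≮j → s≈0 (suc u) (u≮j ∘ ℕ.≤-pred)))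

  parents : ∀ N → List (Maybe (Fin N))
  parents N = nothing ∷ List.map just (allFin N)

  ∑-insert : ∀ {N} m j → j ℕ.+ m ≤ N → ∀ c h → (∀ {v} → j ≤ v → c v ≡ 0) →
    sumMap (insert j c h) (vectors (parents N) m) ≈ vertexProduct j c h m
  ∑-insert     zero    j j+m≤N c h c≡0 = +-identityʳ _
  ∑-insert {N} (suc m) j j+m≤N c h c≡0 = begin
    sumMap (insert j c h) (vectors (parents N) (suc m))
      ≈⟨ sumMap-cartesianProductWith (insert j c h) _∷_ (parents N) Ts ⟩
    sumMap (λ _ → 0#) Ts + sumMap attach (List.map just (allFin N))
      ≈⟨ +-cong (sumMap-0 (λ _ → refl) Ts) (reflexive (sumMap-map attach just (allFin N))) ⟩
    0# + sumMap (attach ∘ just) (allFin N)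
      ≈⟨ +-identityˡ _ ⟩
    sumMap (attach ∘ just) (allFin N)
      ≈⟨ sumMap-tabulate (attach ∘ just) (λ u → u) ⟩
    sum (attach ∘ just)
      ≈⟨ sum-restrict (ℕ.≤-trans (ℕ.m≤m+n j (suc m)) j+m≤N)
           _ (λ u → ∏ j (A [ u ]≔ (A u ∘ suc)) m) attach-yes attach-no ⟩
    ∑[ u < j ] (∏ j (A [ toℕ u ]≔ (A (toℕ u) ∘ suc)) m)
      ≈⟨ leibniz j A m ⟨
    vertexProduct j c h (suc m) ∎
    where
    Ts = vectors (parents N) m

    A : ℕ → Series
    A v = X (c v) (h v)

    attach : Maybe (Fin N) → Carrier
    attach x = sumMap (λ T → insert j c h (x ∷ T)) Ts

    attach-no : ∀ u → ¬ toℕ u ℕ.< j → attach (just u) ≈ 0#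
    attach-no u u≮j = sumMap-0
      (λ T → insert-invalid j c h (just u ∷ T) λ { (u<j ∷ _) → u≮j u<j }) Ts

    attach-yes : ∀ u → toℕ u ℕ.< j → attach (just u) ≈ ∏ j (A [ toℕ u ]≔ (A (toℕ u) ∘ suc)) m
    attach-yes u u<j with toℕ u ℕ.<? j
    ... | no  u≮j = contradiction u<j u≮j
    ... | yes _   = begin
      sumMap (insert (suc j) c′ h′) Ts
        ≈⟨ ∑-insert m (suc j) (≡.subst (_≤ N) (ℕ.+-suc j m) j+m≤N) c′ h′ c′≡0 ⟩
      vertexProduct (suc j) c′ h′ m
        ≈⟨ ∏-last j _ m ⟩
      (vertexProduct j c′ h′ ⊛ X (c′ j) (h′ j)) m
        ≈⟨ ⊛-cong (∏-cong j old) new m ⟩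
      (∏ j (A [ k ]≔ X (suc (c k)) (h k)) ⊛ X 0 (suc (h k))) m
        ≈⟨ ∏-⊛ u<j A _ _ m ⟨
      ∏ j (A [ k ]≔ (X (suc (c k)) (h k) ⊛ X 0 (suc (h k)))) m
        ≈⟨ ∏-cong j (λ {v} _ → updated v) m ⟩
      ∏ j (A [ k ]≔ (A k ∘ suc)) m ∎
      where
      k = toℕ u
      c′ = c [ k ]≔ suc (c k)
      h′ = h [ j ]≔ suc (h k)

      c′≡0 : ∀ {v} → suc j ≤ v → c′ v ≡ 0
      c′≡0 j<v = ≡.trans ([]≔-minimal c (ℕ.>⇒≢ (ℕ.<-trans u<j j<v))) (c≡0 (ℕ.<⇒≤ j<v))

      old : ∀ {v} → v ℕ.< j → ∀ n → X (c′ v) (h′ v) n ≈ (A [ k ]≔ X (suc (c k)) (h k)) v n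
      old {v} v<j n with v ℕ.≟ k
      ... | yes ≡.refl rewrite []≔-minimal h {x = suc (h k)} (ℕ.<⇒≢ v<j)
                             | []≔-updated c k {suc (c k)}
                             | []≔-updated A k {X (suc (c k)) (h k)} = refl
      ... | no  v≢k    rewrite []≔-minimal h {x = suc (h k)} (ℕ.<⇒≢ v<j)
                             | []≔-minimal c {x = suc (c k)} v≢k
                             | []≔-minimal A {x = X (suc (c k)) (h k)} v≢k = refl

      new : ∀ n → X (c′ j) (h′ j) n ≈ X 0 (suc (h k)) n
      new n = reflexive (≡.cong₂ (λ i l → X i l n)
        (≡.trans ([]≔-minimal c (ℕ.>⇒≢ u<j)) (c≡0 ℕ.≤-refl)) ([]≔-updated h j))

      updated : ∀ v n →
        (A [ k ]≔ (X (suc (c k)) (h k) ⊛ X 0 (suc (h k)))) v n ≈ (A [ k ]≔ (A k ∘ suc)) v n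
      updated v n with v ℕ.≟ k
      ... | yes ≡.refl rewrite []≔-updated A k {A k ∘ suc}
                             | []≔-updated A k {X (suc (c k)) (h k) ⊛ X 0 (suc (h k))} =
        sym (X-suc (c k) (h k) n)
      ... | no  v≢k    rewrite []≔-minimal A {x = A k ∘ suc} v≢k
                             | []≔-minimal A {x = X (suc (c k)) (h k) ⊛ X 0 (suc (h k))} v≢k = refl

  ∏-split : ∀ {n} (A : ℕ → Series) (x y : Fin n → Carrier) → (∀ v → A (toℕ v) 0 ≈ x v * y v) →
    ∏ n A 0 ≈ foldr _*_ 1# (List.tabulate x) * foldr _*_ 1# (List.tabulate y)
  ∏-split {zero}  A x y A₀≈ = sym (*-identityˡ 1#)
  ∏-split {suc n} A x y A₀≈ =
    trans (*-cong (A₀≈ zero) (∏-split (A ∘ suc) (x ∘ suc) (y ∘ suc) (A₀≈ ∘ suc)))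
          (*-interchange _ _ _ _)

  insertFrom1 : ∀ {n m} → Vec (Maybe (Fin n)) m → Carrier
  insertFrom1 = insert 1 (λ _ → 0) (λ _ → 0)

  insertFrom1-tree : ∀ {n} {T : Vec (Maybe (Fin (suc n))) n} (t : IsIncreasingTree (nothing ∷ T))
    (x y : Fin (suc n) → Carrier) →
    (∀ v → w (length (children (nothing ∷ T) v)) (height (nothing ∷ T , t) v) ≈ x v * y v) →
    insertFrom1 T ≈ foldr _*_ 1# (List.tabulate x) * foldr _*_ 1# (List.tabulate y)
  insertFrom1-tree {n} {T} t x y w≈xy = begin
    insertFrom1 T
      ≈⟨ insert-valid 1 (λ _ → 0) (λ _ → 0) (proj₂ (tree⇒attaches t)) H H-root H-child ⟩
    ∏ (suc n) (λ v → X (childCount v T) (H v)) 0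
      ≈⟨ ∏-split (λ v → X (childCount v T) (H v)) x y (λ v → trans
           (reflexive (≡.sym (≡.cong₂ w (length-children T⁺ v)
             (≡.sym (extend-toℕ (height tree) v)))))
           (w≈xy v)) ⟩
    foldr _*_ 1# (List.tabulate x) * foldr _*_ 1# (List.tabulate y) ∎
    where
    T⁺ = nothing ∷ T

    tree : IncreasingTree (suc n)
    tree = T⁺ , t

    H : ℕ → ℕ
    H = extend (height tree)

    H-root : ∀ {v} → v ℕ.< 1 → H v ≡ 0
    H-root (s≤s z≤n) = height-root tree {zero} ≡.refl

    H-child : ∀ i {u} → lookup T i ≡ just u → H (suc (toℕ i)) ≡ suc (H (toℕ u))
    H-child i {u} eq = ≡.trans (extend-toℕ (height tree) (suc i))
      (≡.trans (height-child tree eq) (≡.cong suc (≡.sym (extend-toℕ (height tree) u))))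

  ∑-increasingTrees : ∀ {n} (weight : IncreasingTree (suc n) → Carrier) →
    (∀ {T} t → weight (nothing ∷ T , t) ≈ insertFrom1 T) →
    sumMap weight (increasingTrees (suc n)) ≈ X 0 0 n
  ∑-increasingTrees {n} weight weight≈ = begin
    sumMap weight (increasingTrees (suc n))
      ≈⟨ sumMap-mapMaybe weight _ insertFromRoot weight≈insertFromRoot (parentMaps (suc n)) ⟩
    sumMap insertFromRoot (parentMaps (suc n))
      ≈⟨ sumMap-cartesianProductWith insertFromRoot _∷_ (parents (suc n)) Ts ⟩
    sumMap insertFrom1 Ts +
    sumMap (λ x → sumMap (insertFromRoot ∘ (x ∷_)) Ts) (List.map just (allFin (suc n)))
      ≈⟨ +-congˡ (trans (reflexive (sumMap-map _ just (allFin (suc n))))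
           (sumMap-0 (λ _ → sumMap-0 (λ _ → refl) Ts) (allFin (suc n)))) ⟩
    sumMap insertFrom1 Ts + 0#
      ≈⟨ +-identityʳ _ ⟩
    sumMap insertFrom1 Ts
      ≈⟨ ∑-insert n 1 ℕ.≤-refl (λ _ → 0) (λ _ → 0) (λ _ → ≡.refl) ⟩
    (X 0 0 ⊛ 𝟙) n
      ≈⟨ ⊛-comm (X 0 0) 𝟙 n ⟩
    (𝟙 ⊛ X 0 0) n
      ≈⟨ ⊛-identityˡ (X 0 0) n ⟩
    X 0 0 n ∎
    where
    Ts = vectors (parents (suc n)) n

    insertFromRoot : ParentMap (suc n) → Carrier
    insertFromRoot (nothing ∷ T) = insertFrom1 T
    insertFromRoot (just _ ∷ T)  = 0#

    weight≈insertFromRoot : ∀ T →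
      Maybe.maybe weight 0# (Maybe.map (T ,_) (dec⇒maybe (isIncreasingTree? T))) ≈ insertFromRoot T
    weight≈insertFromRoot (nothing ∷ T) with isIncreasingTree? (nothing ∷ T)
    ... | yes t = weight≈ t
    ... | no ¬t = sym (insert-invalid 1 (λ _ → 0) (λ _ → 0) T (¬t ∘ attaches⇒tree))
    weight≈insertFromRoot (just u ∷ T) with isIncreasingTree? (just u ∷ T)
    ... | yes t = contradiction (proj₁ (tree⇒attaches t)) λ ()
    ... | no  _ = refl

  module Substitution {r s} (w-shift : ∀ i h → w i (suc h) ≈ r * w i h) (sr≈1 : s * r ≈ 1#)
    {Φ P : Series} (Φ-coefficients : ∀ k → taylorCoefficients Φ k ≈ w k 0)
    (P₀≈0 : P 0 ≈ 0#) (P-coefficients : ∀ n → taylorCoefficients P n ≈ treeSeries n) where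

    forest-coefficients : ∀ n → taylorCoefficients (Φ ⟨ P ⟩) n ≈ s ^ n * treeSeries (suc n)
    forest-coefficients n = begin
      taylorCoefficients (Φ ⟨ P ⟩) n
        ≈⟨ *-identityˡ _ ⟨
      1# * taylorCoefficients (Φ ⟨ P ⟩) n
        ≈⟨ *-congʳ (inverse-^ sr≈1 n) ⟨
      (s ^ n * r ^ n) * taylorCoefficients (Φ ⟨ P ⟩) n
        ≈⟨ *-assoc _ _ _ ⟩
      s ^ n * (r ^ n * taylorCoefficients (Φ ⟨ P ⟩) n)
        ≈⟨ *-congˡ (*-congˡ (trans (taylorCoefficients-⟨⟩ Φ P P₀≈0 n)
             (sum-cong-≋ {suc n} (λ k → *-cong
               (Φ-coefficients (toℕ k)) (dividedPower-cong P-coefficients (toℕ k) n))))) ⟩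
      s ^ n * (r ^ n * ∑[ k ≤ n ] (w (toℕ k) 0 * dividedPower treeSeries (toℕ k) n))
        ≈⟨ *-congˡ (treeSeries-derivative w-shift n) ⟨
      s ^ n * X 0 0 n ∎

    derivative-coefficients : ∀ n → taylorCoefficients (∂ P ⟨ s *t ⟩) n ≈ s ^ n * treeSeries (suc n)
    derivative-coefficients n = begin
      (n !) · (∂ P ⟨ s *t ⟩) n   ≈⟨ ×-congʳ (n !) (⟨*t⟩ (∂ P) s n) ⟩
      (n !) · (∂ P n * s ^ n)    ≈⟨ ×-assoc-* (n !) _ _ ⟨
      ((n !) · ∂ P n) * s ^ n    ≈⟨ *-comm _ _ ⟩
      s ^ n * ((n !) · ∂ P n)
        ≈⟨ *-congˡ (trans (sym (taylorCoefficients-suc P n)) (P-coefficients (suc n))) ⟩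
      s ^ n * treeSeries (suc n) ∎

-- Specialisation to Laurent polynomials

1/m+n/m : ∀ m .⦃ _ : ℕ.NonZero m ⦄ n → (+ 1) ℚ./ m ℚ.+ (+ n) ℚ./ m ≡ (+ suc n) ℚ./ m
1/m+n/m (suc d) n = ℚ.toℚᵘ-injective (begin
  ℚ.toℚᵘ ((+ 1) ℚ./ suc d ℚ.+ (+ n) ℚ./ suc d)
    ≈⟨ ℚ.toℚᵘ-homo-+ ((+ 1) ℚ./ suc d) ((+ n) ℚ./ suc d) ⟩
  ℚ.toℚᵘ ((+ 1) ℚ./ suc d) ℚᵘ.+ ℚ.toℚᵘ ((+ n) ℚ./ suc d)
    ≈⟨ ℚᵘ.+-cong (ℚ.toℚᵘ-fromℚᵘ (mkℚᵘ (+ 1) d)) (ℚ.toℚᵘ-fromℚᵘ (mkℚᵘ (+ n) d)) ⟩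
  mkℚᵘ (+ 1) d ℚᵘ.+ mkℚᵘ (+ n) d
    ≈⟨ *≡* (crossMultiply (+ n) (+ suc d)) ⟩
  mkℚᵘ (+ suc n) d
    ≈⟨ ℚ.toℚᵘ-fromℚᵘ (mkℚᵘ (+ suc n) d) ⟨
  ℚ.toℚᵘ ((+ suc n) ℚ./ suc d) ∎)
  where
  open SetoidReasoning ℚᵘ.≃-setoid
  crossMultiply : ∀ n m → (+ 1 ℤ.* m ℤ.+ n ℤ.* m) ℤ.* m ≡ (+ 1 ℤ.+ n) ℤ.* (m ℤ.* m)
  crossMultiply = solve-∀

m/m≡1 : ∀ m .⦃ _ : ℕ.NonZero m ⦄ → (+ m) ℚ./ m ≡ ℚ.1ℚ
m/m≡1 (suc d) = ℚ.fromℚᵘ-cong {mkℚᵘ (+ suc d) d} {mkℚᵘ (+ 1) 0} (*≡* (ℤ.*-comm (+ suc d) (+ 1)))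

module PathLength {c ℓ} (R : CommutativeRing c ℓ) (ι : ℚ → CommutativeRing.Carrier R)
  (ι-isRingMonomorphism :
    RingMorphisms.IsRingMonomorphism +-*-rawRing (CommutativeRing.rawRing R) ι)
  (φ : ℕ → CommutativeRing.Carrier R) where
  private
    module R = CommutativeRing R
    module RMult = SemiringMult R.semiring
    module ι = RingMorphisms.IsRingMonomorphism ι-isRingMonomorphism
    K = LaurentRing.laurentSemiring R
  open EnrichedTrees R ι φ using
    (Laurent; q^_; _·_; egf; weight; p; P; F; f; ∂; _⟨_⟩; _*t; _≈ₛ_)
    renaming (const to constant)
  open LaurentRing R using (coeff-∷)
  open CommutativeSemiring K hiding (zero)
  open SemiringMult semiring using (×-assoc-*)
  open SemiringExp semiring using (_^_)
  open HurwitzSeries K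
  open SetoidReasoning setoid

  q^-+ : ∀ i j → q^ i * q^ j ≈ q^ (i ℤ.+ j)
  q^-+ i j k = coeff-∷ {f = []} {g = []} k (≡.refl {x = i ℤ.+ j}) (R.*-identityˡ R.1#) R.refl

  q^-^ : ∀ i n → (q^ i) ^ n ≈ q^ (i ℤ.* + n)
  q^-^ i zero    = reflexive (≡.cong q^_ (≡.sym (ℤ.*-zeroʳ i)))
  q^-^ i (suc n) = begin
    q^ i * (q^ i) ^ n          ≈⟨ *-congˡ {q^ i} {(q^ i) ^ n} {q^ (i ℤ.* + n)} (q^-^ i n) ⟩
    q^ i * q^ (i ℤ.* + n)      ≈⟨ q^-+ i (i ℤ.* + n) ⟩
    q^ (i ℤ.+ i ℤ.* + n)       ≡⟨ ≡.cong q^_ (ℤ.*-suc i (+ n)) ⟨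
    q^ (i ℤ.* + suc n)         ∎

  constant-cong : ∀ {a b} → a R.≈ b → constant a ≈ constant b
  constant-cong a≈b k = coeff-∷ {f = []} {g = []} k (≡.refl {x = 0ℤ}) a≈b R.refl

  constant-+ : ∀ a b → constant a + constant b ≈ constant (a R.+ b)
  constant-+ a b k with 0ℤ ℤ.≟ k in eq
  ... | yes _ rewrite eq = R.sym (R.+-assoc _ _ _)
  ... | no  _ rewrite eq = R.refl

  constant-0 : constant R.0# ≈ 0#
  constant-0 k with 0ℤ ℤ.≟ k
  ... | yes _ = R.+-identityˡ _
  ... | no  _ = R.refl

  ·-constant : ∀ n a → n · constant a ≈ constant (n RMult.× a)
  ·-constant zero    a = sym {constant R.0#} {0#} constant-0
  ·-constant (suc n) a = begin
    constant a + n · constant a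
      ≈⟨ +-congˡ {constant a} {n · constant a} {constant (n RMult.× a)} (·-constant n a) ⟩
    constant a + constant (n RMult.× a)
      ≈⟨ constant-+ a (n RMult.× a) ⟩
    constant (suc n RMult.× a) ∎

  ×-ι-1/ : ∀ m .⦃ _ : ℕ.NonZero m ⦄ n → n RMult.× ι ((+ 1) ℚ./ m) R.≈ ι ((+ n) ℚ./ m)
  ×-ι-1/ m zero    = R.sym (R.trans (R.reflexive (≡.cong ι (ℚ.0/n≡0 m))) ι.0#-homo)
  ×-ι-1/ m (suc n) = R.trans (R.+-congˡ (×-ι-1/ m n))
    (R.trans (R.sym (ι.+-homo _ _)) (R.reflexive (≡.cong ι (1/m+n/m m n))))

  1/_! : ℕ → Laurent
  1/ n ! = constant (ι (ℚ._/_ (+ 1) (n !) ⦃ n ℕ.!≢0 ⦄))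

  n!·1/n! : ∀ n → (n !) · 1/ n ! ≈ 1#
  n!·1/n! n = begin
    (n !) · 1/ n !
      ≈⟨ ·-constant (n !) _ ⟩
    constant ((n !) RMult.× ι (ℚ._/_ (+ 1) (n !) ⦃ n ℕ.!≢0 ⦄))
      ≈⟨ constant-cong (R.trans (×-ι-1/ (n !) ⦃ n ℕ.!≢0 ⦄ (n !))
           (R.trans (R.reflexive (≡.cong ι (m/m≡1 (n !) ⦃ n ℕ.!≢0 ⦄))) ι.1#-homo)) ⟩
    1# ∎

  n!·egf : ∀ a n → taylorCoefficients (egf a) n ≈ a n
  n!·egf a n = begin
    (n !) · (1/ n ! * a n)  ≈⟨ ×-assoc-* (n !) (1/ n !) (a n) ⟨
    ((n !) · 1/ n !) * a n  ≈⟨ *-congʳ {a n} {(n !) · 1/ n !} {1#} (n!·1/n! n) ⟩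
    1# * a n                ≈⟨ *-identityˡ (a n) ⟩
    a n                     ∎

  w : ℕ → ℕ → Laurent
  w i h = q^ (+ h) * constant (φ i)

  open Insertion K w

  w-shift : ∀ i h → w i (suc h) ≈ q^ (+ 1) * w i h
  w-shift i h = begin
    q^ (+ suc h) * constant (φ i)
      ≈⟨ *-congʳ {constant (φ i)} {q^ (+ 1) * q^ (+ h)} {q^ (+ suc h)} (q^-+ (+ 1) (+ h)) ⟨
    (q^ (+ 1) * q^ (+ h)) * constant (φ i)
      ≈⟨ *-assoc (q^ (+ 1)) (q^ (+ h)) (constant (φ i)) ⟩
    q^ (+ 1) * w i h ∎

  product-q^ : ∀ hs → foldr _*_ 1# (List.map (q^_ ∘ +_) hs) ≈ q^ (+ sumℕ hs)
  product-q^ []       = refl {1#}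
  product-q^ (h ∷ hs) = begin
    q^ (+ h) * foldr _*_ 1# (List.map (q^_ ∘ +_) hs)
      ≈⟨ *-congˡ {q^ (+ h)} {foldr _*_ 1# (List.map (q^_ ∘ +_) hs)} {q^ (+ sumℕ hs)}
           (product-q^ hs) ⟩
    q^ (+ h) * q^ (+ sumℕ hs)
      ≈⟨ q^-+ (+ h) (+ sumℕ hs) ⟩
    q^ (+ sumℕ (h ∷ hs)) ∎

  product-constant : ∀ as → foldr _*_ 1# (List.map constant as) ≡ constant (foldr R._*_ R.1# as)
  product-constant []       = ≡.refl
  product-constant (a ∷ as) = ≡.cong (constant a *_) (product-constant as)

  weight≈insert : ∀ {n} {T : Vec (Maybe (Fin (suc n))) n} (t : IsIncreasingTree (nothing ∷ T)) →
    weight (nothing ∷ T , t) ≈ insertFrom1 T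
  weight≈insert {n} {T} t = begin
    q^ (+ sumℕ hs) * constant (foldr R._*_ R.1# as)
      ≈⟨ *-congʳ {constant (foldr R._*_ R.1# as)}
           {foldr _*_ 1# (List.map (q^_ ∘ +_) hs)} {q^ (+ sumℕ hs)}
           (product-q^ hs) ⟨
    foldr _*_ 1# (List.map (q^_ ∘ +_) hs) * constant (foldr R._*_ R.1# as)
      ≡⟨ ≡.cong (foldr _*_ 1# (List.map (q^_ ∘ +_) hs) *_) (product-constant as) ⟨
    foldr _*_ 1# (List.map (q^_ ∘ +_) hs) * foldr _*_ 1# (List.map constant as)
      ≡⟨ ≡.cong₂ (λ xs ys → foldr _*_ 1# xs * foldr _*_ 1# ys)
           (map-allFin (q^_ ∘ +_) _) (map-allFin constant _) ⟩
    foldr _*_ 1# (List.tabulate (q^_ ∘ +_ ∘ height tree)) *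
    foldr _*_ 1# (List.tabulate (constant ∘ φ ∘ length ∘ children (nothing ∷ T)))
      ≈⟨ insertFrom1-tree t (q^_ ∘ +_ ∘ height tree)
           (constant ∘ φ ∘ length ∘ children (nothing ∷ T))
           (λ v → refl {w (length (children (nothing ∷ T) v)) (height tree v)}) ⟨
    insertFrom1 T ∎
    where
    tree : IncreasingTree (suc n)
    tree = nothing ∷ T , t

    hs = List.map (height tree) (allFin (suc n))
    as = List.map (φ ∘ length ∘ children (nothing ∷ T)) (allFin (suc n))

    map-allFin : ∀ {a b} {A : Set a} {B : Set b} (g : A → B) (h : Fin (suc n) → A) →
      List.map g (List.map h (allFin (suc n))) ≡ List.tabulate (g ∘ h)
    map-allFin g h =
      ≡.trans (≡.sym (List.map-∘ (allFin (suc n)))) (List.map-tabulate (λ v → v) (g ∘ h))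

  p-suc : ∀ n → p (suc n) ≈ treeSeries (suc n)
  p-suc n = ∑-increasingTrees {n} weight weight≈insert

  P-coefficients : ∀ n → taylorCoefficients P n ≈ treeSeries n
  P-coefficients zero    = n!·egf (λ _ → 0#) 0
  P-coefficients (suc n) = begin
    taylorCoefficients P (suc n)  ≈⟨ n!·egf (λ _ → p (suc n)) (suc n) ⟩
    p (suc n)                     ≈⟨ p-suc n ⟩
    treeSeries (suc n)            ∎

  Φ-coefficients : ∀ k → taylorCoefficients (egf (constant ∘ φ)) k ≈ w k 0
  Φ-coefficients k = begin
    taylorCoefficients (egf (constant ∘ φ)) k  ≈⟨ n!·egf (constant ∘ φ) k ⟩
    constant (φ k)                             ≈⟨ *-identityˡ (constant (φ k)) ⟨
    w k 0                                      ∎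

  open Substitution {q^ (+ 1)} {q^ -1ℤ} w-shift (q^-+ -1ℤ (+ 1)) {egf (constant ∘ φ)} {P}
    Φ-coefficients (zeroʳ (1/ 0 !)) P-coefficients

  F≈∂P : F ≈ₛ (∂ P ⟨ (q^ -1ℤ) *t ⟩)
  F≈∂P n = ×-cancelˡ (n !) {1/ n !} (n!·1/n! n) {F n} {(∂ P ⟨ (q^ -1ℤ) *t ⟩) n} (begin
    (n !) · F n                            ≈⟨ forest-coefficients n ⟩
    (q^ -1ℤ) ^ n * treeSeries (suc n)      ≈⟨ derivative-coefficients n ⟨
    (n !) · (∂ P ⟨ (q^ -1ℤ) *t ⟩) n        ∎)

  f≈p : ∀ n → f n ≈ (q^ (ℤ.- (+ n))) * p (suc n)
  f≈p n = begin
    f n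
      ≈⟨ forest-coefficients n ⟩
    (q^ -1ℤ) ^ n * treeSeries (suc n)
      ≈⟨ *-cong {(q^ -1ℤ) ^ n} {q^ (-1ℤ ℤ.* + n)} {treeSeries (suc n)} {p (suc n)} (q^-^ -1ℤ n)
           (sym {p (suc n)} {treeSeries (suc n)} (p-suc n)) ⟩
    (q^ (-1ℤ ℤ.* + n)) * p (suc n)
      ≡⟨ ≡.cong (λ i → (q^ i) * p (suc n)) (ℤ.-1*i≡-i (+ n)) ⟩
    (q^ (ℤ.- (+ n))) * p (suc n) ∎

corollary1 : ∀ {c ℓ} (R : CommutativeRing c ℓ) (ι : ℚ → CommutativeRing.Carrier R) →
    RingMorphisms.IsRingMonomorphism +-*-rawRing (CommutativeRing.rawRing R) ι →
    (φ : ℕ → CommutativeRing.Carrier R) →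
    ¬ (CommutativeRing._≈_ R (φ 0) (CommutativeRing.0# R)) →
    let open EnrichedTrees R ι φ in
    (F ≈ₛ (∂ P ⟨ (q^ -1ℤ) *t ⟩)) × (∀ n → f n ≈ (q^ (ℤ.- (+ n))) * p (suc n))
corollary1 R ι ι-mono φ _ = F≈∂P , f≈p
  where open PathLength R ι ι-mono φ
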